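{- Let $H$ be a finite graph on at least $12$ vertices. Then at least one of the graphs $H$ and $\overline{H}$ (the complement of $H$), call it $X$, satisfies one of the following: (i) $X$ is a clique; (ii) $X$ is a forest with a unique vertex of maximum degree; (iii) the $2$-core of $X$ is isomorphic to $K_{2,p}$ or to $K_{1,1,p}$ for some $p\geq 3$; (iv) the $3^*$-core of $X$ is $3$-connected and not a clique.
   Context: The $2$-core of a graph is obtained by iteratively removing vertices having fewer than $2$ neighbours (in the current graph). The $3^*$-core of a graph is obtained by iteratively removing vertices which have at most $2$ neighbours and removing pairs of distinct vertices $u,v$ with $|N[u]\cup N[v]|\leq 4$, where $N[v]$ is the closed neighbourhood of $v$ in the current graph. $K_{2,p}$ is the complete bipartite graph with parts of sizes $2$ and $p$, and $K_{1,1,p}$ is the complete tripartite graph with parts of sizes $1,1,p$. A graph is $k$-connected if it has at least $k+1$ vertices and remains connected after removing any $k-1$ vertices. -}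

module Defs where

open import Data.Nat using (ℕ; suc; _+_; _≤_; _<_)
open import Data.Bool using (Bool; true; false; not; _∧_; _xor_)
open import Data.Fin using (Fin; zero; suc; toℕ; inject₁; fromℕ)
open import Data.Fin.Subset using (Subset; _∈_; _⊆_; _∩_; _∪_; _─_; _-_; ∣_∣; ⁅_⁆; ⊤)
open import Data.Vec using (tabulate)
open import Data.Product using (Σ; ∃; _×_; _,_)
open import Data.Sum using (_⊎_)
open import Relation.Nullary using (¬_; ⌊_⌋)
open import Relation.Nullary.Decidable using (⌊_⌋)
open import Relation.Binary.PropositionalEquality using (_≡_; _≢_)
open import Relation.Binary.Construct.Closure.ReflexiveTransitive using (Star)
open import Function.Definitions using (Injective)
import Data.Fin as F
import Data.Nat as N

Adj : ℕ → Set
Adj n = Fin n → Fin n → Bool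

IsSimpleGraph : ∀ {n} → Adj n → Set
IsSimpleGraph {n} a = (∀ (i j : Fin n) → a i j ≡ a j i) × (∀ (i : Fin n) → a i i ≡ false)

complement : ∀ {n} → Adj n → Adj n
complement a i j = not (a i j) ∧ not ⌊ i F.≟ j ⌋

module _ {n : ℕ} (a : Adj n) where

  nbhd : Subset n → Fin n → Subset n
  nbhd S v = tabulate (a v) ∩ S

  cnbhd : Subset n → Fin n → Subset n
  cnbhd S v = ⁅ v ⁆ ∪ nbhd S v

  deg : Subset n → Fin n → ℕ
  deg S v = ∣ nbhd S v ∣

  data Step2 : Subset n → Subset n → Set where
    del : ∀ {S} v → v ∈ S → deg S v < 2 → Step2 S (S - v)

  data Step3* : Subset n → Subset n → Set where
    delv : ∀ {S} v → v ∈ S → deg S v ≤ 2 → Step3* S (S - v)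
    delp : ∀ {S} u v → u ∈ S → v ∈ S → u ≢ v →
           ∣ cnbhd S u ∪ cnbhd S v ∣ ≤ 4 → Step3* S ((S - u) - v)

  IsCoreFor : (Subset n → Subset n → Set) → Subset n → Set
  IsCoreFor R S = Star R ⊤ S × (∀ S' → ¬ R S S')

  Is2Core : Subset n → Set
  Is2Core = IsCoreFor Step2

  Is3*Core : Subset n → Set
  Is3*Core = IsCoreFor Step3*

  CliqueOn : Subset n → Set
  CliqueOn S = ∀ u v → u ∈ S → v ∈ S → u ≢ v → a u v ≡ true

  EdgeIn : Subset n → Fin n → Fin n → Set
  EdgeIn T u v = u ∈ T × v ∈ T × a u v ≡ true

  ConnectedOn : Subset n → Set
  ConnectedOn T = ∀ u v → u ∈ T → v ∈ T → Star (EdgeIn T) u v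

  ThreeConnectedOn : Subset n → Set
  ThreeConnectedOn S = 4 ≤ ∣ S ∣ × (∀ R → R ⊆ S → ∣ R ∣ ≤ 2 → ConnectedOn (S ─ R))

  IsoOn : ∀ {m} → Adj m → Subset n → Set
  IsoOn {m} b S = Σ (Fin m → Fin n) λ f →
    Injective _≡_ _≡_ f × (∀ i → f i ∈ S) × (∀ v → v ∈ S → ∃ λ i → f i ≡ v)
    × (∀ i j → a (f i) (f j) ≡ b i j)

  Cycle : ℕ → Set
  Cycle k = Σ (Fin (3 + k) → Fin n) λ f → Injective _≡_ _≡_ f ×
    (∀ (i : Fin (2 + k)) → a (f (inject₁ i)) (f (suc i)) ≡ true) ×
    a (f (fromℕ (2 + k))) (f zero) ≡ true

  Forest : Set
  Forest = ∀ k → ¬ Cycle k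

  UniqueMaxDegree : Set
  UniqueMaxDegree = ∃ λ v → ∀ w → w ≢ v → deg ⊤ w < deg ⊤ v

-- K_{2,p} on Fin (2 + p): vertices 0,1 form one part, the rest the other
K2 : (p : ℕ) → Adj (2 + p)
K2 p i j = ⌊ toℕ i N.<? 2 ⌋ xor ⌊ toℕ j N.<? 2 ⌋

-- K_{1,1,p} on Fin (2 + p): parts {0}, {1}, {2,…,p+1}
K11 : (p : ℕ) → Adj (2 + p)
K11 p i j = not ⌊ i F.≟ j ⌋ ∧ not (⌊ 2 N.≤? toℕ i ⌋ ∧ ⌊ 2 N.≤? toℕ j ⌋)

Good : ∀ {n} → Adj n → Set
Good {n} a =
    CliqueOn a ⊤
  ⊎ (Forest a × UniqueMaxDegree a)
  ⊎ (∃ λ S → Is2Core a S × ∃ λ p → 3 ≤ p × (IsoOn a (K2 p) S ⊎ IsoOn a (K11 p) S))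
  ⊎ (∃ λ S → Is3*Core a S × ThreeConnectedOn a S × ¬ CliqueOn a S)

{-# OPTIONS --safe #-}
module Submission where

-- Let S be the 3*-core of H, and suppose that R with |R| ≤ 2 separates S into sides
-- A and B. The pair rule forces |A|, |B| ≥ 3, so the complement contains a complete
-- bipartite graph between A and B, and every vertex removed on the way to S misses at
-- most two vertices of A ∪ B in the complement. Hence the 3*-core of the complement
-- contains everything outside R; it is 3-connected, and it is not a clique.
--
-- Otherwise both 3*-cores may be assumed to be empty or cliques on at least 5 vertices.
-- If the complement reduces to L, every vertex outside L has at least |L| − 2
-- neighbours in L in H. On the other hand a reduction of H deletes on average at most
-- two edges between L and its complement per vertex, which leaves at most 2n − 4 such
-- edges. For n ≥ 12 and |L| ≥ 5 this forces |V ∖ L| ≤ 2. If both cores are empty,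
-- stopping at |L| ∈ {5, 6} gives a contradiction; if L is a clique of the complement,
-- H has all its edges at no more than two vertices, and (i), (ii) or (iii) holds.

open import Defs
open import Data.Nat using (ℕ; zero; suc; _+_; _*_; _≤_; _<_; z≤n; s≤s; s≤s⁻¹)
open import Data.Nat.Properties hiding (_≟_; suc-injective)
open import Data.Nat.Tactic.RingSolver using (solve-∀)
open import Algebra.Properties.CommutativeSemigroup +-commutativeSemigroup using (interchange; xy∙z≈xz∙y)
open import Data.Bool using (Bool; true; false; not; _∧_)
open import Data.Bool.Properties using (not-injective; not-involutive; ∧-zeroʳ; ∧-identityʳ)
import Data.Bool.Properties as B
open import Data.Fin using (Fin; zero; suc; inject₁; fromℕ; _≟_)
open import Data.Fin.Properties using (any?; all?; suc-injective)
open import Data.Fin.Subset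
open import Data.Fin.Subset.Properties
open import Data.Vec using ([]; _∷_; tabulate; here; there)
open import Data.Vec.Properties using ([]=⇒lookup; lookup⇒[]=; lookup∘tabulate)
open import Data.Product using (∃; _×_; _,_; proj₁; proj₂)
open import Data.Sum using (_⊎_; inj₁; inj₂; [_,_]′; swap)
open import Data.Empty using (⊥-elim) renaming (⊥ to Absurd)
open import Function using (_∘_; id)
open import Function.Definitions using (Injective)
open import Relation.Nullary using (¬_; Dec; yes; no)
open import Relation.Nullary.Decidable using (_×-dec_; _→-dec_; ¬?; ⌊_⌋; decidable-stable)
open import Relation.Binary.PropositionalEquality
open import Relation.Binary.Construct.Closure.ReflexiveTransitive using (Star; ε; _◅_; _◅◅_)

private variable
  n : ℕ

-- Cardinalities of finite subsets under covers, insertions and deletions.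

x∈p─q⇒x∉q : ∀ {x} (p q : Subset n) → x ∈ p ─ q → x ∉ q
x∈p─q⇒x∉q (_ ∷ p) (true  ∷ q) (there i) (there j) = x∈p─q⇒x∉q p q i j
x∈p─q⇒x∉q (_ ∷ p) (false ∷ q) (there i) (there j) = x∈p─q⇒x∉q p q i j

x∈p-y⇒x≢y : ∀ {x y} (p : Subset n) → x ∈ p - y → x ≢ y
x∈p-y⇒x≢y {y = y} p i refl = x∈p─q⇒x∉q p ⁅ y ⁆ i (x∈⁅x⁆ y)

∣p∪q∣+∣p∩q∣≡∣p∣+∣q∣ : (p q : Subset n) → ∣ p ∪ q ∣ + ∣ p ∩ q ∣ ≡ ∣ p ∣ + ∣ q ∣
∣p∪q∣+∣p∩q∣≡∣p∣+∣q∣ [] [] = refl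
∣p∪q∣+∣p∩q∣≡∣p∣+∣q∣ (true ∷ p) (true ∷ q) = cong suc
  (trans (+-suc _ _) (trans (cong suc (∣p∪q∣+∣p∩q∣≡∣p∣+∣q∣ p q)) (sym (+-suc _ _))))
∣p∪q∣+∣p∩q∣≡∣p∣+∣q∣ (true ∷ p) (false ∷ q) = cong suc (∣p∪q∣+∣p∩q∣≡∣p∣+∣q∣ p q)
∣p∪q∣+∣p∩q∣≡∣p∣+∣q∣ (false ∷ p) (true ∷ q) =
  trans (cong suc (∣p∪q∣+∣p∩q∣≡∣p∣+∣q∣ p q)) (sym (+-suc _ _))
∣p∪q∣+∣p∩q∣≡∣p∣+∣q∣ (false ∷ p) (false ∷ q) = ∣p∪q∣+∣p∩q∣≡∣p∣+∣q∣ p q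

∣∣-cover : (p q r : Subset n) → (∀ {x} → x ∈ p → x ∈ q ⊎ x ∈ r) → ∣ p ∣ ≤ ∣ q ∣ + ∣ r ∣
∣∣-cover p q r c = ≤-trans (p⊆q⇒∣p∣≤∣q∣ (x∈p∪q⁺ ∘ c))
  (≤-trans (m≤m+n _ _) (≤-reflexive (∣p∪q∣+∣p∩q∣≡∣p∣+∣q∣ q r)))

∣∣-disjoint : (p q r : Subset n) → p ⊆ r → q ⊆ r → (∀ {x} → x ∈ p → x ∉ q) → ∣ p ∣ + ∣ q ∣ ≤ ∣ r ∣
∣∣-disjoint {n} p q r p⊆r q⊆r d = begin
  ∣ p ∣ + ∣ q ∣          ≡⟨ ∣p∪q∣+∣p∩q∣≡∣p∣+∣q∣ p q ⟨
  ∣ p ∪ q ∣ + ∣ p ∩ q ∣  ≡⟨ cong (λ s → ∣ p ∪ q ∣ + ∣ s ∣) empty ⟩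
  ∣ p ∪ q ∣ + ∣ ⊥ {n} ∣  ≡⟨ cong (∣ p ∪ q ∣ +_) (∣⊥∣≡0 n) ⟩
  ∣ p ∪ q ∣ + 0          ≡⟨ +-identityʳ _ ⟩
  ∣ p ∪ q ∣              ≤⟨ p⊆q⇒∣p∣≤∣q∣ (λ i → [ p⊆r , q⊆r ]′ (x∈p∪q⁻ p q i)) ⟩
  ∣ r ∣                  ∎
  where
  open ≤-Reasoning
  empty : p ∩ q ≡ ⊥
  empty = Empty-unique λ (_ , i) → d (proj₁ (x∈p∩q⁻ p q i)) (proj₂ (x∈p∩q⁻ p q i))

∣∣-insert : ∀ {x} (p r : Subset n) → p ⊆ r → x ∈ r → x ∉ p → suc ∣ p ∣ ≤ ∣ r ∣
∣∣-insert {x = x} p r p⊆r x∈r x∉p = subst (λ k → k + ∣ p ∣ ≤ ∣ r ∣) (∣⁅x⁆∣≡1 x)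
  (∣∣-disjoint ⁅ x ⁆ p r (λ i → subst (_∈ r) (sym (x∈⁅y⁆⇒x≡y x i)) x∈r) p⊆r
    (λ i j → x∉p (subst (_∈ p) (x∈⁅y⁆⇒x≡y x i) j)))

∣p∣≡1+∣p-x∣ : ∀ {x} {p : Subset n} → x ∈ p → ∣ p ∣ ≡ suc ∣ p - x ∣
∣p∣≡1+∣p-x∣ {x = x} {p} x∈p = ≤-antisym
  (subst (λ k → ∣ p ∣ ≤ k + ∣ p - x ∣) (∣⁅x⁆∣≡1 x) (∣∣-cover p ⁅ x ⁆ (p - x) cover))
  (x∈p⇒∣p-x∣<∣p∣ x∈p)
  where
  cover : ∀ {y} → y ∈ p → y ∈ ⁅ x ⁆ ⊎ y ∈ p - x
  cover {y} i with y ≟ x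
  ... | yes refl = inj₁ (x∈⁅x⁆ y)
  ... | no y≢x = inj₂ (x∈p∧x≢y⇒x∈p-y i y≢x)

pick : (p q : Subset n) → ∣ q ∣ < ∣ p ∣ → ∃ λ x → x ∈ p × x ∉ q
pick p q lt with nonempty? (p ─ q)
... | yes (x , i) = x , p─q⊆p p q i , x∈p─q⇒x∉q p q i
... | no e = ⊥-elim (<⇒≱ lt (p⊆q⇒∣p∣≤∣q∣ p⊆q))
  where
  p⊆q : p ⊆ q
  p⊆q {x} i with x ∈? q
  ... | yes j = j
  ... | no x∉q = ⊥-elim (e (x , x∈p∧x∉q⇒x∈p─q i x∉q))

Empty⇒∣p∣≡0 : {p : Subset n} → Empty p → ∣ p ∣ ≡ 0
Empty⇒∣p∣≡0 {n} e = trans (cong ∣_∣ (Empty-unique e)) (∣⊥∣≡0 n)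

0<∣p∣ : ∀ {x} {p : Subset n} → x ∈ p → 0 < ∣ p ∣
0<∣p∣ i = subst (0 <_) (sym (∣p∣≡1+∣p-x∣ i)) (s≤s z≤n)

-- Enumeration of subsets, sums over them, and counts with two extra elements.

enumerate : (p : Subset n) → Fin ∣ p ∣ → Fin n
enumerate (true  ∷ p) zero    = zero
enumerate (true  ∷ p) (suc i) = suc (enumerate p i)
enumerate (false ∷ p) i       = suc (enumerate p i)

enumerate-∈ : (p : Subset n) (i : Fin ∣ p ∣) → enumerate p i ∈ p
enumerate-∈ (true  ∷ p) zero    = here
enumerate-∈ (true  ∷ p) (suc i) = there (enumerate-∈ p i)
enumerate-∈ (false ∷ p) i       = there (enumerate-∈ p i)

enumerate-injective : (p : Subset n) → Injective _≡_ _≡_ (enumerate p)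
enumerate-injective (true ∷ p) {zero} {zero} e = refl
enumerate-injective (true ∷ p) {suc i} {suc j} e = cong suc (enumerate-injective p (suc-injective e))
enumerate-injective (false ∷ p) e = enumerate-injective p (suc-injective e)

enumerate-surjective : (p : Subset n) → ∀ {x} → x ∈ p → ∃ λ i → enumerate p i ≡ x
enumerate-surjective (true ∷ p) here = zero , refl
enumerate-surjective (true ∷ p) (there x∈p) with enumerate-surjective p x∈p
... | i , e = suc i , cong suc e
enumerate-surjective (false ∷ p) (there x∈p) with enumerate-surjective p x∈p
... | i , e = i , cong suc e

∑∈ : Subset n → (Fin n → ℕ) → ℕ
∑∈ []          f = 0
∑∈ (true  ∷ p) f = f zero + ∑∈ p (f ∘ suc)
∑∈ (false ∷ p) f = ∑∈ p (f ∘ suc)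

∑∈-mono : (p : Subset n) {f g : Fin n → ℕ} → (∀ {i} → i ∈ p → f i ≤ g i) → ∑∈ p f ≤ ∑∈ p g
∑∈-mono []          le = z≤n
∑∈-mono (true  ∷ p) le = +-mono-≤ (le here) (∑∈-mono p (le ∘ there))
∑∈-mono (false ∷ p) le = ∑∈-mono p (le ∘ there)

∑∈-cong : (p : Subset n) {f g : Fin n → ℕ} → (∀ i → f i ≡ g i) → ∑∈ p f ≡ ∑∈ p g
∑∈-cong p e = ≤-antisym (∑∈-mono p λ {i} _ → ≤-reflexive (e i)) (∑∈-mono p λ {i} _ → ≤-reflexive (sym (e i)))

∑∈-const : (p : Subset n) (c : ℕ) → ∑∈ p (λ _ → c) ≡ ∣ p ∣ * c
∑∈-const []          c = refl
∑∈-const (true  ∷ p) c = cong (c +_) (∑∈-const p c)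
∑∈-const (false ∷ p) c = ∑∈-const p c

∑∈-+ : (p : Subset n) (f g : Fin n → ℕ) → ∑∈ p (λ i → f i + g i) ≡ ∑∈ p f + ∑∈ p g
∑∈-+ []          f g = refl
∑∈-+ (false ∷ p) f g = ∑∈-+ p (f ∘ suc) (g ∘ suc)
∑∈-+ (true  ∷ p) f g = trans (cong ((f zero + g zero) +_) (∑∈-+ p (f ∘ suc) (g ∘ suc)))
  (interchange (f zero) (g zero) _ _)

∑∈-delete : (p : Subset n) (f : Fin n → ℕ) → ∀ {v} → v ∈ p → ∑∈ p f ≡ f v + ∑∈ (p - v) f
∑∈-delete (true ∷ p) f here = cong (λ q → f zero + ∑∈ q (f ∘ suc)) (sym (p─⊥≡p p))
∑∈-delete (true ∷ p) f (there {i = v} i) = begin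
  f zero + ∑∈ p (f ∘ suc)                        ≡⟨ cong (f zero +_) (∑∈-delete p (f ∘ suc) i) ⟩
  f zero + (f (suc v) + ∑∈ (p - v) (f ∘ suc))   ≡⟨ +-assoc (f zero) _ _ ⟨
  (f zero + f (suc v)) + ∑∈ (p - v) (f ∘ suc)   ≡⟨ cong (_+ ∑∈ (p - v) (f ∘ suc)) (+-comm (f zero) _) ⟩
  (f (suc v) + f zero) + ∑∈ (p - v) (f ∘ suc)   ≡⟨ +-assoc (f (suc v)) _ _ ⟩
  f (suc v) + (f zero + ∑∈ (p - v) (f ∘ suc))   ∎
  where open ≡-Reasoning
∑∈-delete (false ∷ p) f (there i) = ∑∈-delete p (f ∘ suc) i

χ : Bool → ℕ
χ true  = 1
χ false = 0

-- Turns a sum of edge indicators into a degree, since `deg a S v` unfolds to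
-- `∣ tabulate (a v) ∩ S ∣`.
∑∈-χ : (p : Subset n) (s : Fin n → Bool) → ∑∈ p (χ ∘ s) ≡ ∣ tabulate s ∩ p ∣
∑∈-χ [] s = refl
∑∈-χ (true ∷ p) s with s zero
... | true  = cong suc (∑∈-χ p (s ∘ suc))
... | false = ∑∈-χ p (s ∘ suc)
∑∈-χ (false ∷ p) s with s zero
... | true  = ∑∈-χ p (s ∘ suc)
... | false = ∑∈-χ p (s ∘ suc)

∣∣-insert₂ : ∀ {x y} (p r : Subset n) → p ⊆ r → x ∈ r → y ∈ r → x ≢ y → x ∉ p → y ∉ p → 2 + ∣ p ∣ ≤ ∣ r ∣
∣∣-insert₂ {x = x} {y} p r p⊆r x∈r y∈r x≢y x∉p y∉p = subst (2 + ∣ p ∣ ≤_) (sym (∣p∣≡1+∣p-x∣ x∈r))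
  (s≤s (∣∣-insert p (r - x)
    (λ i → x∈p∧x≢y⇒x∈p-y (p⊆r i) λ { refl → x∉p i }) (x∈p∧x≢y⇒x∈p-y y∈r (x≢y ∘ sym)) y∉p))

∣p∣≡2+∣p-x-y∣ : ∀ {x y} {p : Subset n} → x ∈ p → y ∈ p → x ≢ y → ∣ p ∣ ≡ 2 + ∣ p - x - y ∣
∣p∣≡2+∣p-x-y∣ x∈p y∈p x≢y = trans (∣p∣≡1+∣p-x∣ x∈p)
  (cong suc (∣p∣≡1+∣p-x∣ (x∈p∧x≢y⇒x∈p-y y∈p (x≢y ∘ sym))))

-- Neighbourhoods, robust sets and the `3*`-reduction.

module _ (a : Adj n) where

  ∈nbhd⁺ : ∀ {S v x} → a v x ≡ true → x ∈ S → x ∈ nbhd a S v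
  ∈nbhd⁺ {S} {v} {x} e i = x∈p∩q⁺ (lookup⇒[]= x _ (trans (lookup∘tabulate (a v) x) e) , i)

  ∈nbhd⁻ : ∀ {S v x} → x ∈ nbhd a S v → a v x ≡ true × x ∈ S
  ∈nbhd⁻ {S} {v} {x} i with x∈p∩q⁻ (tabulate (a v)) S i
  ... | j , k = trans (sym (lookup∘tabulate (a v) x)) ([]=⇒lookup j) , k

  nbhd-mono : ∀ {S T} → S ⊆ T → ∀ v → nbhd a S v ⊆ nbhd a T v
  nbhd-mono S⊆T v i with ∈nbhd⁻ i
  ... | e , j = ∈nbhd⁺ e (S⊆T j)

  v∈cnbhd : ∀ S v → v ∈ cnbhd a S v
  v∈cnbhd S v = x∈p∪q⁺ (inj₁ (x∈⁅x⁆ v))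

  nbhd⊆cnbhd : ∀ S v → nbhd a S v ⊆ cnbhd a S v
  nbhd⊆cnbhd S v i = x∈p∪q⁺ (inj₂ i)

  cnbhd-mono : ∀ {S T} → S ⊆ T → ∀ v → cnbhd a S v ⊆ cnbhd a T v
  cnbhd-mono S⊆T v i with x∈p∪q⁻ ⁅ v ⁆ _ i
  ... | inj₁ j = x∈p∪q⁺ (inj₁ j)
  ... | inj₂ j = x∈p∪q⁺ (inj₂ (nbhd-mono S⊆T v j))

  cpair : Subset n → Fin n → Fin n → Subset n
  cpair S u v = cnbhd a S u ∪ cnbhd a S v

  cnbhdˡ : ∀ S u v → cnbhd a S u ⊆ cpair S u v
  cnbhdˡ S u v i = x∈p∪q⁺ (inj₁ i)

  cnbhdʳ : ∀ S u v → cnbhd a S v ⊆ cpair S u v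
  cnbhdʳ S u v i = x∈p∪q⁺ (inj₂ i)

  nbhdˡ : ∀ S u v → nbhd a S u ⊆ cpair S u v
  nbhdˡ S u v = cnbhdˡ S u v ∘ nbhd⊆cnbhd S u

  nbhdʳ : ∀ S u v → nbhd a S v ⊆ cpair S u v
  nbhdʳ S u v = cnbhdʳ S u v ∘ nbhd⊆cnbhd S v

  cpair-mono : ∀ {S T} → S ⊆ T → ∀ u v → cpair S u v ⊆ cpair T u v
  cpair-mono S⊆T u v i with x∈p∪q⁻ (cnbhd a _ u) _ i
  ... | inj₁ j = cnbhdˡ _ u v (cnbhd-mono S⊆T u j)
  ... | inj₂ j = cnbhdʳ _ u v (cnbhd-mono S⊆T v j)

  cnbhd⊆ : ∀ {S v} → v ∈ S → cnbhd a S v ⊆ S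
  cnbhd⊆ {S} {v} v∈S i with x∈p∪q⁻ ⁅ v ⁆ _ i
  ... | inj₁ j = subst (_∈ S) (sym (x∈⁅y⁆⇒x≡y v j)) v∈S
  ... | inj₂ j = proj₂ (∈nbhd⁻ j)

  cpair⊆ : ∀ {S u v} → u ∈ S → v ∈ S → cpair S u v ⊆ S
  cpair⊆ u∈S v∈S i with x∈p∪q⁻ (cnbhd a _ _) _ i
  ... | inj₁ j = cnbhd⊆ u∈S j
  ... | inj₂ j = cnbhd⊆ v∈S j

  -- The two clauses negate the premises of `delv` and `delp`. Both bounds persist when the ambient
  -- set grows, so a robust set never loses a vertex and bounds every core from below.
  Robust : Subset n → Set
  Robust S = (∀ {v} → v ∈ S → 3 ≤ deg a S v)
           × (∀ {u v} → u ∈ S → v ∈ S → u ≢ v → 5 ≤ ∣ cpair S u v ∣)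

  Robust⇒irreducible : ∀ {S} → Robust S → ∀ S' → ¬ Step3* a S S'
  Robust⇒irreducible (d , p) _ (delv v v∈S le)         = <⇒≱ (d v∈S) le
  Robust⇒irreducible (d , p) _ (delp u v u∈S v∈S ne le) = <⇒≱ (p u∈S v∈S ne) le

  module _ (simple : IsSimpleGraph a) where

    a-sym : ∀ {u v c} → a u v ≡ c → a v u ≡ c
    a-sym {u} {v} e = trans (proj₁ simple v u) e

    a⇒≢ : ∀ {u v} → a u v ≡ true → u ≢ v
    a⇒≢ {u} e refl with trans (sym e) (proj₂ simple u)
    ... | ()

    v∉nbhd : ∀ {S v} → v ∉ nbhd a S v
    v∉nbhd i = a⇒≢ (proj₁ (∈nbhd⁻ i)) refl

    1+deg≤∣cnbhd∣ : ∀ S v → suc (deg a S v) ≤ ∣ cnbhd a S v ∣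
    1+deg≤∣cnbhd∣ S v = ∣∣-insert (nbhd a S v) _ (nbhd⊆cnbhd S v) (v∈cnbhd S v) v∉nbhd

    -- Only `u` has to lie in `W`: if `v` does not, then `u`, three neighbours of `u` in `W`, and
    -- `v` already make five.
    Robust⇒5≤∣cpair∣ : ∀ {W S u v} → Robust W → W ⊆ S → u ∈ W → u ≢ v → 5 ≤ ∣ cpair S u v ∣
    Robust⇒5≤∣cpair∣ {W} {S} {u} {v} (d , p) W⊆S u∈W u≢v with v ∈? W
    ... | yes v∈W = ≤-trans (p u∈W v∈W u≢v) (p⊆q⇒∣p∣≤∣q∣ (cpair-mono W⊆S u v))
    ... | no v∉W = ≤-trans (s≤s (≤-trans (s≤s (d u∈W)) (1+deg≤∣cnbhd∣ W u)))
      (∣∣-insert (cnbhd a W u) _ (cnbhdˡ S u v ∘ cnbhd-mono W⊆S u)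
        (cnbhdʳ S u v (v∈cnbhd S v)) (v∉W ∘ cnbhd⊆ u∈W))

    -- Neighbourhoods only grow from `W` to `S`, so neither rule can delete a vertex of `W`.
    Robust-step : ∀ {W S S'} → Robust W → W ⊆ S → Step3* a S S' → W ⊆ S'
    Robust-step (d , p) W⊆S (delv v v∈S le) i = x∈p∧x≢y⇒x∈p-y (W⊆S i)
      λ { refl → <⇒≱ (≤-trans (d i) (p⊆q⇒∣p∣≤∣q∣ (nbhd-mono W⊆S v))) le }
    Robust-step {W} {S} r W⊆S (delp u v u∈S v∈S u≢v le) {x} i =
      x∈p∧x≢y⇒x∈p-y (x∈p∧x≢y⇒x∈p-y (W⊆S i)
        (λ { refl → <⇒≱ (Robust⇒5≤∣cpair∣ r W⊆S i u≢v) le }))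
        (λ { refl → <⇒≱ (Robust⇒5≤∣cpair∣ r W⊆S i (u≢v ∘ sym))
               (subst (λ s → ∣ s ∣ ≤ 4) (∪-comm (cnbhd a S u) (cnbhd a S v)) le) })

    Robust-⊆ : ∀ {W S S'} → Robust W → W ⊆ S → Star (Step3* a) S S' → W ⊆ S'
    Robust-⊆ r W⊆S ε        = W⊆S
    Robust-⊆ r W⊆S (s ◅ ss) = Robust-⊆ r (Robust-step r W⊆S s) ss

  step-⊆ : ∀ {S S'} → Step3* a S S' → S' ⊆ S
  step-⊆ (delv v _ _)       = p─q⊆p _ _
  step-⊆ (delp u v _ _ _ _) = p─q⊆p _ _ ∘ p─q⊆p _ _

  steps-⊆ : ∀ {S S'} → Star (Step3* a) S S' → S' ⊆ S
  steps-⊆ ε        = id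
  steps-⊆ (s ◅ ss) = step-⊆ s ∘ steps-⊆ ss

  step-< : ∀ {S S'} → Step3* a S S' → ∣ S' ∣ < ∣ S ∣
  step-< (delv v v∈S _) = x∈p⇒∣p-x∣<∣p∣ v∈S
  step-< {S} (delp u v u∈S _ _ _) = ≤-<-trans (∣p─q∣≤∣p∣ (S - u) ⁅ v ⁆) (x∈p⇒∣p-x∣<∣p∣ u∈S)

  step-size : ∀ {S S'} → Step3* a S S' → ∣ S ∣ ≤ 2 + ∣ S' ∣
  step-size (delv v v∈S _) = ≤-trans (≤-reflexive (∣p∣≡1+∣p-x∣ v∈S)) (n≤1+n _)
  step-size (delp u v u∈S v∈S u≢v _) = ≤-reflexive (∣p∣≡2+∣p-x-y∣ u∈S v∈S u≢v)

  -- `u` and `v` themselves occupy two of the at most four places in `N[u] ∪ N[v]`. Hence the pair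
  -- rule yields the same bound of two on surviving neighbours as the degree rule.
  pair-outside : ∀ {S p u v} → u ≢ v → ∣ cpair S u v ∣ ≤ 4 → p ⊆ cpair S u v → u ∉ p → v ∉ p → ∣ p ∣ ≤ 2
  pair-outside {S} {p} {u} {v} u≢v le p⊆ u∉p v∉p = +-cancelˡ-≤ 2 _ _ (≤-trans
    (∣∣-insert₂ p (cpair S u v) p⊆ (cnbhdˡ S u v (v∈cnbhd S u)) (cnbhdʳ S u v (v∈cnbhd S v)) u≢v u∉p v∉p) le)

  -- A removed vertex keeps its few neighbours, all the more so among the survivors.
  removed-deg : ∀ {S T v} → Star (Step3* a) S T → v ∈ S → v ∉ T → deg a T v ≤ 2
  removed-deg ε v∈S v∉T = ⊥-elim (v∉T v∈S)
  removed-deg {S} {T} {v} (delv w _ le ◅ ss) v∈S v∉T with v ≟ w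
  ... | yes refl = ≤-trans (p⊆q⇒∣p∣≤∣q∣ (nbhd-mono (p─q⊆p S ⁅ v ⁆ ∘ steps-⊆ ss) v)) le
  ... | no v≢w   = removed-deg ss (x∈p∧x≢y⇒x∈p-y v∈S v≢w) v∉T
  removed-deg {S} {T} {v} (delp u w u∈S w∈S u≢w le ◅ ss) v∈S v∉T with v ≟ u | v ≟ w
  ... | no v≢u | no v≢w = removed-deg ss (x∈p∧x≢y⇒x∈p-y (x∈p∧x≢y⇒x∈p-y v∈S v≢u) v≢w) v∉T
  ... | yes refl | _ = pair-outside u≢w le (nbhdˡ S u w ∘ nbhd-mono T⊆S v) (u∉T ∘ proj₂ ∘ ∈nbhd⁻) (w∉T ∘ proj₂ ∘ ∈nbhd⁻)
    where
    T⊆S = steps-⊆ (delp u w u∈S w∈S u≢w le ◅ ss)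
    u∉T = λ i → x∈p-y⇒x≢y S (p─q⊆p _ _ (steps-⊆ ss i)) refl
    w∉T = λ i → x∈p-y⇒x≢y (S - u) (steps-⊆ ss i) refl
  ... | no _ | yes refl = pair-outside u≢w le (nbhdʳ S u w ∘ nbhd-mono T⊆S v) (u∉T ∘ proj₂ ∘ ∈nbhd⁻) (w∉T ∘ proj₂ ∘ ∈nbhd⁻)
    where
    T⊆S = steps-⊆ (delp u w u∈S w∈S u≢w le ◅ ss)
    u∉T = λ i → x∈p-y⇒x≢y S (p─q⊆p _ _ (steps-⊆ ss i)) refl
    w∉T = λ i → x∈p-y⇒x≢y (S - u) (steps-⊆ ss i) refl

  step? : ∀ S → (∃ λ S' → Step3* a S S') ⊎ Robust S
  step? S with any? (λ v → (v ∈? S) ×-dec (deg a S v ≤? 2))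
  ... | yes (v , v∈S , le) = inj₁ (_ , delv v v∈S le)
  ... | no ¬v with any? (λ u → any? (λ v →
    (u ∈? S) ×-dec (v ∈? S) ×-dec ¬? (u ≟ v) ×-dec (∣ cpair S u v ∣ ≤? 4)))
  ...   | yes (u , v , u∈S , v∈S , u≢v , le) = inj₁ (_ , delp u v u∈S v∈S u≢v le)
  ...   | no ¬p = inj₂ ((λ {v} v∈S → ≰⇒> λ le → ¬v (v , v∈S , le))
                      , (λ {u} {v} u∈S v∈S u≢v → ≰⇒> λ le → ¬p (u , v , u∈S , v∈S , u≢v , le)))

  reduce : ∀ k S → ∣ S ∣ ≤ k → ∃ λ T → Star (Step3* a) S T × Robust T
  reduce k S le with step? S
  ... | inj₂ r = S , ε , r
  reduce zero S le | inj₁ (S' , s) = ⊥-elim (<⇒≱ (step-< s) (≤-trans le z≤n))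
  reduce (suc k) S le | inj₁ (S' , s) with reduce k S' (s≤s⁻¹ (≤-trans (step-< s) le))
  ... | T , ss , r = T , s ◅ ss , r

  core : ∃ λ S → Star (Step3* a) ⊤ S × Robust S
  core = reduce _ ⊤ ≤-refl

-- Cuts, connectivity and the possible shapes of a core.

module _ (a : Adj n) where

  -- A witness that `T` is disconnected. Unlike the absence of a path, it can be searched for among
  -- the finitely many subsets.
  record Cut (T C : Subset n) : Set where
    constructor cut
    field
      C⊆T      : C ⊆ T
      nonempty : Nonempty C
      rest     : Nonempty (T ─ C)
      noEdge   : ∀ x y → x ∈ C → y ∈ T ─ C → a x y ≡ false

  cut? : ∀ T C → Dec (Cut T C)
  cut? T C with (C ⊆? T) ×-dec nonempty? C ×-dec nonempty? (T ─ C) ×-dec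
    all? (λ x → all? (λ y → (x ∈? C) →-dec (y ∈? T ─ C) →-dec (a x y B.≟ false)))
  ... | yes (p , q , r , s) = yes (cut p q r s)
  ... | no ¬c = no λ (cut p q r s) → ¬c (p , q , r , s)

  -- The set of vertices reached from `u` is enlarged along outgoing edges; if none leaves it before
  -- `v` is reached, it is itself a cut.
  uncut⇒connected : ∀ {T} → (∀ C → ¬ Cut T C) → ConnectedOn a T
  uncut⇒connected {T} uncut u v u∈T v∈T =
    grow n ⁅ u ⁆ (m≤m+n n _) (λ i → subst (_∈ T) (sym (x∈⁅y⁆⇒x≡y u i)) u∈T) (x∈⁅x⁆ u)
      (λ i → subst (Star (EdgeIn a T) u) (sym (x∈⁅y⁆⇒x≡y u i)) ε)
    where
    -- `k` bounds the number of vertices outside `C`; at `k = 0` the set `C` is everything and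
    -- contains `v`.
    grow : ∀ k C → n ≤ k + ∣ C ∣ → C ⊆ T → u ∈ C → (∀ {x} → x ∈ C → Star (EdgeIn a T) u x) →
           Star (EdgeIn a T) u v
    grow k C le C⊆T u∈C reach with v ∈? C
    ... | yes v∈C = reach v∈C
    ... | no v∉C with any? (λ x → any? (λ y → (x ∈? C) ×-dec (y ∈? T ─ C) ×-dec (a x y B.≟ true)))
    ...   | no none = ⊥-elim (uncut C (cut C⊆T (u , u∈C) (v , x∈p∧x∉q⇒x∈p─q v∈T v∉C)
              λ x y i j → B.¬-not λ e → none (x , y , i , j , e)))
    grow zero C le C⊆T u∈C reach | no v∉C | yes (x , y , x∈C , y∈T─C , e) =
      ⊥-elim (v∉C (subst (v ∈_) (sym (∣p∣≡n⇒p≡⊤ (≤-antisym (∣p∣≤n C) le))) ∈⊤))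
    grow (suc k) C le C⊆T u∈C reach | no v∉C | yes (x , y , x∈C , y∈T─C , e) =
      grow k (C ∪ ⁅ y ⁆)
        (≤-trans le (≤-trans (≤-reflexive (sym (+-suc k ∣ C ∣)))
          (+-monoʳ-≤ k (∣∣-insert C (C ∪ ⁅ y ⁆) (p⊆p∪q ⁅ y ⁆) (x∈p∪q⁺ (inj₂ (x∈⁅x⁆ y)))
            (x∈p─q⇒x∉q T C y∈T─C)))))
        (λ i → [ C⊆T , (λ j → subst (_∈ T) (sym (x∈⁅y⁆⇒x≡y y j)) y∈T) ]′ (x∈p∪q⁻ C ⁅ y ⁆ i))
        (x∈p∪q⁺ (inj₁ u∈C))
        (λ i → [ reach , (λ j → subst (Star (EdgeIn a T) u) (sym (x∈⁅y⁆⇒x≡y y j))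
                   (reach x∈C ◅◅ (C⊆T x∈C , y∈T , e) ◅ ε)) ]′ (x∈p∪q⁻ C ⁅ y ⁆ i))
      where y∈T = p─q⊆p T C y∈T─C

  SmallCut : Subset n → Subset n → Set
  SmallCut S R = R ⊆ S × ∣ R ∣ ≤ 2 × ∃ (Cut (S ─ R))

  -- The pair rule is what excludes a side consisting of two vertices.
  Robust⇒3≤∣side∣ : IsSimpleGraph a → ∀ {S A} R → Robust a S → Nonempty A → A ⊆ S → ∣ R ∣ ≤ 2 →
    (∀ {x y} → x ∈ A → y ∈ S → a x y ≡ true → y ∈ A ⊎ y ∈ R) → 3 ≤ ∣ A ∣
  Robust⇒3≤∣side∣ simple {S} {A} R (d , p) (x , x∈A) A⊆S R≤2 closed = ≰⇒> λ A≤2 →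
    -- Not all of the three neighbours of `x` fit into `R`, so one of them, `y`, is in `A`; then
    -- `N[x] ∪ N[y]` lies in `A ∪ R`, which has at most four vertices.
    let y , y∈N , y∉R = pick (nbhd a S x) R (≤-<-trans R≤2 (d (A⊆S x∈A)))
        x~y , y∈S = ∈nbhd⁻ a y∈N
        y∈A = [ id , ⊥-elim ∘ y∉R ]′ (closed x∈A y∈S x~y)
        x≢y = a⇒≢ a simple x~y
    in <⇒≱ (p (A⊆S x∈A) y∈S x≢y)
         (≤-trans (∣∣-cover (cpair a S x y) A R
           (λ i → [ inside-or-cut x∈A , inside-or-cut y∈A ]′ (x∈p∪q⁻ (cnbhd a S x) _ i)))
           (+-mono-≤ A≤2 R≤2))
    where
    inside-or-cut : ∀ {u z} → u ∈ A → z ∈ cnbhd a S u → z ∈ A ⊎ z ∈ R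
    inside-or-cut {u} u∈A i with x∈p∪q⁻ ⁅ u ⁆ _ i
    ... | inj₁ j = inj₁ (subst (_∈ A) (sym (x∈⁅y⁆⇒x≡y u j)) u∈A)
    ... | inj₂ j = closed u∈A (proj₂ (∈nbhd⁻ a j)) (proj₁ (∈nbhd⁻ a j))

  data CoreShape (S : Subset n) : Set where
    empty     : ∣ S ∣ ≡ 0 → CoreShape S
    good      : ThreeConnectedOn a S → ¬ CliqueOn a S → CoreShape S
    clique    : 5 ≤ ∣ S ∣ → CliqueOn a S → CoreShape S
    separated : ∀ R → SmallCut S R → CoreShape S

  cliqueOn? : ∀ S → Dec (CliqueOn a S)
  cliqueOn? S = all? (λ u → all? (λ v →
    (u ∈? S) →-dec (v ∈? S) →-dec ¬? (u ≟ v) →-dec (a u v B.≟ true)))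

  coreShape : IsSimpleGraph a → ∀ {S} → Robust a S → CoreShape S
  coreShape simple {S} r@(d , p) with nonempty? S
  ... | no e = empty (Empty⇒∣p∣≡0 e)
  ... | yes (x , x∈S)
    with anySubset? (λ R → (R ⊆? S) ×-dec (∣ R ∣ ≤? 2) ×-dec anySubset? (cut? (S ─ R)))
  ...   | yes (R , c) = separated R c
  ...   | no uncut with cliqueOn? S
  ...     | yes c = clique 5≤ c
    where
    -- A nonempty robust set has an edge, and `N[x] ∪ N[y]` for its ends provides five vertices.
    5≤ : 5 ≤ ∣ S ∣
    5≤ with pick (nbhd a S x) ⊥ (≤-<-trans (≤-trans (≤-reflexive (∣⊥∣≡0 n)) z≤n) (d x∈S))
    ... | y , i , _ with ∈nbhd⁻ a i
    ...   | x~y , y∈S = ≤-trans (p x∈S y∈S (a⇒≢ a simple x~y)) (p⊆q⇒∣p∣≤∣q∣ (cpair⊆ a x∈S y∈S))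
  ...     | no ¬c = good
    ( ≤-trans (s≤s (d x∈S)) (≤-trans (1+deg≤∣cnbhd∣ a simple S x) (p⊆q⇒∣p∣≤∣q∣ (cnbhd⊆ a x∈S)))
    , (λ R R⊆S R≤2 → uncut⇒connected λ C c → uncut (R , R⊆S , R≤2 , C , c)))
    ¬c

-- Complementary graphs and the two sides of a small cut.

∈∧∉⇒≢ : ∀ {x y} {p : Subset n} → x ∈ p → y ∉ p → x ≢ y
∈∧∉⇒≢ x∈p y∉p refl = y∉p x∈p

-- A symmetric relation instead of the function `complement`, so that later results apply with the
-- two graphs exchanged.
record Complementary (a b : Adj n) : Set where
  field
    simpleˡ : IsSimpleGraph a
    simpleʳ : IsSimpleGraph b
    flips   : ∀ {u v} → u ≢ v → b u v ≡ not (a u v)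

  false⇒true : ∀ {u v} → u ≢ v → a u v ≡ false → b u v ≡ true
  false⇒true u≢v e = trans (flips u≢v) (cong not e)

  true⇒false : ∀ {u v} → b u v ≡ true → a u v ≡ false
  true⇒false e = not-injective (trans (sym (flips (a⇒≢ b simpleʳ e))) e)

  nbr-⊎ : ∀ {S u v} → u ∈ S → u ≢ v → u ∈ nbhd a S v ⊎ u ∈ nbhd b S v
  nbr-⊎ {S} {u} {v} u∈S u≢v with a v u in e
  ... | true  = inj₁ (∈nbhd⁺ a e u∈S)
  ... | false = inj₂ (∈nbhd⁺ b (false⇒true (u≢v ∘ sym) e) u∈S)

Complementary-sym : ∀ {a b : Adj n} → Complementary a b → Complementary b a
Complementary-sym {a = a} c = record
  { simpleˡ = simpleʳ
  ; simpleʳ = simpleˡ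
  ; flips   = λ {u} {v} u≢v → trans (sym (not-involutive (a u v))) (cong not (sym (flips u≢v)))
  }
  where open Complementary c

module _ {a b : Adj n} (compl : Complementary a b) where
  open Complementary compl

  -- A small cut with both sides treated alike: statements about `A` transfer to `B` through
  -- `Sides-sym`.
  record Sides (S R A B : Subset n) : Set where
    field
      A⊆S    : A ⊆ S
      B⊆S    : B ⊆ S
      S⊆     : ∀ {x} → x ∈ S → x ∈ R ⊎ x ∈ A ⊎ x ∈ B
      A∌     : ∀ {x} → x ∈ A → x ∉ R
      B∌     : ∀ {x} → x ∈ B → x ∉ R
      A≢B    : ∀ {x} → x ∈ A → x ∉ B
      3≤∣A∣  : 3 ≤ ∣ A ∣
      3≤∣B∣  : 3 ≤ ∣ B ∣
      across : ∀ {x y} → x ∈ A → y ∈ B → a x y ≡ false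

    crossing : ∀ {x y} → x ∈ A → y ∈ B → b x y ≡ true
    crossing {x} x∈A y∈B = false⇒true (λ { refl → A≢B x∈A y∈B }) (across x∈A y∈B)

  Sides-sym : ∀ {S R A B} → Sides S R A B → Sides S R B A
  Sides-sym s = record
    { A⊆S = B⊆S ; B⊆S = A⊆S ; S⊆ = λ i → [ inj₁ , inj₂ ∘ swap ]′ (S⊆ i)
    ; A∌ = B∌ ; B∌ = A∌ ; A≢B = λ i j → A≢B j i ; 3≤∣A∣ = 3≤∣B∣ ; 3≤∣B∣ = 3≤∣A∣
    ; across = λ i j → a-sym a simpleˡ (across j i) }
    where open Sides s

  sides : ∀ {S R C} → Robust a S → ∣ R ∣ ≤ 2 → Cut a (S ─ R) C → Sides S R C (S ─ R ─ C)
  sides {S} {R} {C} r R≤2 (cut C⊆ ne rest noEdge) = record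
    { A⊆S = A⊆S
    ; B⊆S = B⊆S
    ; S⊆ = split
    ; A∌ = x∈p─q⇒x∉q S R ∘ C⊆
    ; B∌ = x∈p─q⇒x∉q S R ∘ p─q⊆p _ C
    ; A≢B = λ i j → x∈p─q⇒x∉q (S ─ R) C j i
    ; 3≤∣A∣ = Robust⇒3≤∣side∣ a simpleˡ R r ne A⊆S R≤2 closedA
    ; 3≤∣B∣ = Robust⇒3≤∣side∣ a simpleˡ R r rest B⊆S R≤2 closedB
    ; across = λ i j → noEdge _ _ i j
    }
    where
    A⊆S : C ⊆ S
    A⊆S i = p─q⊆p S R (C⊆ i)
    B⊆S : S ─ R ─ C ⊆ S
    B⊆S i = p─q⊆p S R (p─q⊆p _ C i)
    split : ∀ {x} → x ∈ S → x ∈ R ⊎ x ∈ C ⊎ x ∈ S ─ R ─ C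
    split {x} x∈S with x ∈? R | x ∈? C
    ... | yes i | _ = inj₁ i
    ... | no _ | yes i = inj₂ (inj₁ i)
    ... | no i | no j = inj₂ (inj₂ (x∈p∧x∉q⇒x∈p─q (x∈p∧x∉q⇒x∈p─q x∈S i) j))
    clash : ∀ {x y} → x ∈ C → y ∈ S ─ R ─ C → a x y ≢ true
    clash i j e with trans (sym e) (noEdge _ _ i j)
    ... | ()
    closedA : ∀ {x y} → x ∈ C → y ∈ S → a x y ≡ true → y ∈ C ⊎ y ∈ R
    closedA i y∈S e with split y∈S
    ... | inj₁ j = inj₂ j
    ... | inj₂ (inj₁ j) = inj₁ j
    ... | inj₂ (inj₂ j) = ⊥-elim (clash i j e)
    closedB : ∀ {x y} → x ∈ S ─ R ─ C → y ∈ S → a x y ≡ true → y ∈ S ─ R ─ C ⊎ y ∈ R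
    closedB i y∈S e with split y∈S
    ... | inj₁ j = inj₂ j
    ... | inj₂ (inj₁ j) = ⊥-elim (clash j i (a-sym a simpleˡ e))
    ... | inj₂ (inj₂ j) = inj₁ j

-- A small cut of one core makes the other core 3-connected.

module _ {a b : Adj n} (compl : Complementary a b) where
  open Complementary compl
  open Sides

  module _ {S R : Subset n} (⊤⟶S : Star (Step3* a) ⊤ S) (R⊆S : R ⊆ S) (R≤2 : ∣ R ∣ ≤ 2) where

    6≤∣A∪B∣ : ∀ {A B} → Sides compl S R A B → 6 ≤ ∣ A ∪ B ∣
    6≤∣A∪B∣ {A} {B} s = ≤-trans (+-mono-≤ (3≤∣A∣ s) (3≤∣B∣ s))
      (∣∣-disjoint A B (A ∪ B) (p⊆p∪q B) (q⊆p∪q A B) (A≢B s))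

    A∪B⊆∁R : ∀ {A B} → Sides compl S R A B → A ∪ B ⊆ ∁ R
    A∪B⊆∁R {A} {B} s i = [ x∉p⇒x∈∁p ∘ A∌ s , x∉p⇒x∈∁p ∘ B∌ s ]′ (x∈p∪q⁻ A B i)

    A∪B⊆S : ∀ {A B} → Sides compl S R A B → A ∪ B ⊆ S
    A∪B⊆S {A} {B} s i = [ A⊆S s , B⊆S s ]′ (x∈p∪q⁻ A B i)

    data Place (A B : Subset n) (x : Fin n) : Set where
      inA : x ∈ A → Place A B x
      inB : x ∈ B → Place A B x
      out : x ∉ S → Place A B x

    place : ∀ {A B} → Sides compl S R A B → ∀ {x} → x ∉ R → Place A B x
    place s {x} x∉R with x ∈? S
    ... | no x∉S = out x∉S
    ... | yes x∈S with S⊆ s x∈S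
    ...   | inj₁ x∈R = ⊥-elim (x∉R x∈R)
    ...   | inj₂ (inj₁ i) = inA i
    ...   | inj₂ (inj₂ i) = inB i

    -- `A ∪ B` has at least six vertices, and at most two of them are `a`-neighbours of the removed
    -- vertex `x`; the rest are `b`-neighbours.
    4≤deg-out : ∀ {A B} → Sides compl S R A B → ∀ {x} → x ∉ S → 4 ≤ deg b (∁ R) x
    4≤deg-out {A} {B} s {x} x∉S = +-cancelˡ-≤ 2 _ _ (≤-trans (6≤∣A∪B∣ s)
      (≤-trans (∣∣-cover (A ∪ B) (nbhd a S x) (nbhd b (∁ R) x) split)
        (+-monoˡ-≤ _ (removed-deg a ⊤⟶S ∈⊤ x∉S))))
      where
      split : ∀ {y} → y ∈ A ∪ B → y ∈ nbhd a S x ⊎ y ∈ nbhd b (∁ R) x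
      split {y} i with nbr-⊎ {v = x} (A∪B⊆S s i) (∈∧∉⇒≢ (A∪B⊆S s i) x∉S)
      ... | inj₁ j = inj₁ j
      ... | inj₂ j = inj₂ (∈nbhd⁺ b (proj₁ (∈nbhd⁻ b j)) (A∪B⊆∁R s i))

    B⊆nbhd : ∀ {A B} → Sides compl S R A B → ∀ {x} → x ∈ A → B ⊆ nbhd b (∁ R) x
    B⊆nbhd s x∈A i = ∈nbhd⁺ b (crossing s x∈A i) (x∉p⇒x∈∁p (B∌ s i))

    sides⇒3≤deg : ∀ {A B} → Sides compl S R A B → ∀ {x} → x ∈ ∁ R → 3 ≤ deg b (∁ R) x
    sides⇒3≤deg s i with place s (x∈∁p⇒x∉p i)
    ... | inA j = ≤-trans (3≤∣B∣ s) (p⊆q⇒∣p∣≤∣q∣ (B⊆nbhd s j))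
    ... | inB j = ≤-trans (3≤∣A∣ s) (p⊆q⇒∣p∣≤∣q∣ (B⊆nbhd (Sides-sym compl s) j))
    ... | out j = ≤-trans (n≤1+n 3) (4≤deg-out s j)

    5≤cpair-out : ∀ {A B} → Sides compl S R A B → ∀ {u} v → u ∉ S → 5 ≤ ∣ cpair b (∁ R) u v ∣
    5≤cpair-out s {u} v i = ≤-trans (s≤s (4≤deg-out s i))
      (≤-trans (1+deg≤∣cnbhd∣ b simpleʳ (∁ R) u) (p⊆q⇒∣p∣≤∣q∣ (cnbhdˡ b (∁ R) u v)))

    -- All of `B`, at least three vertices, is adjacent to `u` in `b`; `u` and `v` themselves are
    -- the other two.
    5≤cpair-side : ∀ {A B} → Sides compl S R A B → ∀ {u v} → u ∈ A → v ∈ A → u ≢ v → 5 ≤ ∣ cpair b (∁ R) u v ∣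
    5≤cpair-side {B = B} s {u} {v} i j u≢v = ≤-trans (s≤s (s≤s (3≤∣B∣ s)))
      (∣∣-insert₂ B (cpair b (∁ R) u v) (nbhdˡ b (∁ R) u v ∘ B⊆nbhd s i)
        (cnbhdˡ b (∁ R) u v (v∈cnbhd b (∁ R) u)) (cnbhdʳ b (∁ R) u v (v∈cnbhd b (∁ R) v))
        u≢v (A≢B s i) (A≢B s j))

    5≤cpair-across : ∀ {A B} → Sides compl S R A B → ∀ {u v} → u ∈ A → v ∈ B → 5 ≤ ∣ cpair b (∁ R) u v ∣
    5≤cpair-across {A} {B} s {u} {v} i j = ≤-trans (n≤1+n 5) (≤-trans (6≤∣A∪B∣ s)
      (p⊆q⇒∣p∣≤∣q∣ λ k → [ nbhdʳ b (∁ R) u v ∘ B⊆nbhd (Sides-sym compl s) j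
                        , nbhdˡ b (∁ R) u v ∘ B⊆nbhd s i ]′ (x∈p∪q⁻ A B k)))

    -- With `Robust-⊆` this puts every vertex outside `R`, even those deleted on the way to `S`,
    -- into the `3*`-core of `b`.
    sides⇒Robust : ∀ {A B} → Sides compl S R A B → Robust b (∁ R)
    sides⇒Robust s = sides⇒3≤deg s , pair
      where
      pair : ∀ {u v} → u ∈ ∁ R → v ∈ ∁ R → u ≢ v → 5 ≤ ∣ cpair b (∁ R) u v ∣
      pair {u} {v} i j u≢v with place s (x∈∁p⇒x∉p i) | place s (x∈∁p⇒x∉p j)
      ... | out k | _     = 5≤cpair-out s v k
      ... | _     | out k = subst (λ t → 5 ≤ ∣ t ∣) (∪-comm (cnbhd b (∁ R) v) (cnbhd b (∁ R) u)) (5≤cpair-out s u k)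
      ... | inA k | inA l = 5≤cpair-side s k l u≢v
      ... | inB k | inB l = 5≤cpair-side (Sides-sym compl s) k l u≢v
      ... | inA k | inB l = 5≤cpair-across s k l
      ... | inB k | inA l = 5≤cpair-across (Sides-sym compl s) k l

    module _ {Z Q : Subset n} (∁R⊆Z : ∁ R ⊆ Z) (Q≤2 : ∣ Q ∣ ≤ 2) where

      -- In `b`, `x` sees all of `B`, so the part of `B` outside `Q` lies in `C`, and a vertex of it
      -- keeps `A` out of `D` as well. A vertex of `D` outside `R` was therefore deleted on the way
      -- to `S`; it has a `b`-neighbour in `A ∪ B` outside `Q`, which can be neither in `C` nor in
      -- `D`.
      one-sided : ∀ {A B C D x} → Sides compl S R A B → (∀ {y} → y ∈ Z ─ Q → y ∈ C ⊎ y ∈ D) →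
        (∀ {y z} → y ∈ C → z ∈ D → b y z ≡ false) → x ∈ A → x ∈ C → 3 ≤ ∣ D ∣ → D ⊆ Z ─ Q → Absurd
      one-sided {A} {B} {C} {D} {x} s cover noEdge x∈A x∈C 3≤D D⊆ =
        let y , y∈B , y∉Q = pick B Q (≤-<-trans Q≤2 (3≤∣B∣ s))
            y∈C = B⊆C y∈B y∉Q
            d , d∈D , d∉R = pick D R (≤-<-trans R≤2 3≤D)
        in absurd y∈B y∈C d∈D (place s d∉R)
        where
        clash : ∀ {y z} → y ∈ C → z ∈ D → b y z ≢ true
        clash i j e with trans (sym e) (noEdge i j)
        ... | ()
        A∪B∖Q⊆ : ∀ {y} → y ∈ A ∪ B → y ∉ Q → y ∈ C ⊎ y ∈ D
        A∪B∖Q⊆ i y∉Q = cover (x∈p∧x∉q⇒x∈p─q (∁R⊆Z (A∪B⊆∁R s i)) y∉Q)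
        B⊆C : ∀ {y} → y ∈ B → y ∉ Q → y ∈ C
        B⊆C i y∉Q with A∪B∖Q⊆ (x∈p∪q⁺ (inj₂ i)) y∉Q
        ... | inj₁ j = j
        ... | inj₂ j = ⊥-elim (clash x∈C j (crossing s x∈A i))
        A∪B-misses-D : ∀ {y d} → y ∈ B → y ∈ C → d ∈ D → d ∉ A ∪ B
        A∪B-misses-D y∈B y∈C d∈D i with x∈p∪q⁻ A B i
        ... | inj₁ j = clash y∈C d∈D (a-sym b simpleʳ (crossing s j y∈B))
        ... | inj₂ j = clash x∈C d∈D (crossing s x∈A j)
        absurd : ∀ {y d} → y ∈ B → y ∈ C → d ∈ D → Place A B d → Absurd
        absurd y∈B y∈C d∈D (inA i) = A∪B-misses-D y∈B y∈C d∈D (x∈p∪q⁺ (inj₁ i))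
        absurd y∈B y∈C d∈D (inB i) = A∪B-misses-D y∈B y∈C d∈D (x∈p∪q⁺ (inj₂ i))
        absurd {y} {d} y∈B y∈C d∈D (out d∉S) =
          -- Of the six or more vertices of `A ∪ B`, at most two are `a`-neighbours of `d` and at
          -- most two lie in `Q`.
          let w , w∈A∪B , w∉ = pick (A ∪ B) (nbhd a S d ∪ Q) few
              d~w = [ ⊥-elim ∘ w∉ ∘ x∈p∪q⁺ ∘ inj₁ , proj₁ ∘ ∈nbhd⁻ b ]′
                      (nbr-⊎ {v = d} (A∪B⊆S s w∈A∪B) (∈∧∉⇒≢ (A∪B⊆S s w∈A∪B) d∉S))
          in [ (λ w∈C → clash w∈C d∈D (a-sym b simpleʳ d~w))
             , (λ w∈D → A∪B-misses-D y∈B y∈C w∈D w∈A∪B)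
             ]′ (A∪B∖Q⊆ w∈A∪B (w∉ ∘ x∈p∪q⁺ ∘ inj₂))
          where
          few : ∣ nbhd a S d ∪ Q ∣ < ∣ A ∪ B ∣
          few = ≤-<-trans (∣∣-cover (nbhd a S d ∪ Q) (nbhd a S d) Q (x∈p∪q⁻ _ Q))
            (≤-<-trans (+-mono-≤ (removed-deg a ⊤⟶S ∈⊤ d∉S) Q≤2) (≤-trans (n≤1+n 5) (6≤∣A∪B∣ s)))

  separated⇒Good : ∀ {S R} → Star (Step3* a) ⊤ S → Robust a S → SmallCut a S R → Good b
  separated⇒Good {S} {R} ⊤⟶S r (R⊆S , R≤2 , A , c) =
    inj₂ (inj₂ (inj₂ (Z , (⊤⟶Z , Robust⇒irreducible b rZ) , (4≤Z , connected) , ¬clique)))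
    where
    B = S ─ R ─ A
    s : Sides compl S R A B
    s = sides compl r R≤2 c
    Z = proj₁ (core b)
    ⊤⟶Z = proj₁ (proj₂ (core b))
    rZ = proj₂ (proj₂ (core b))
    ∁R⊆Z : ∁ R ⊆ Z
    ∁R⊆Z = Robust-⊆ b simpleʳ (sides⇒Robust ⊤⟶S R⊆S R≤2 s) (λ _ → ∈⊤) ⊤⟶Z
    4≤Z : 4 ≤ ∣ Z ∣
    4≤Z = ≤-trans (≤-trans (m≤n+m 4 2) (6≤∣A∪B∣ ⊤⟶S R⊆S R≤2 s))
      (p⊆q⇒∣p∣≤∣q∣ (∁R⊆Z ∘ A∪B⊆∁R ⊤⟶S R⊆S R≤2 s))
    ¬clique : ¬ CliqueOn b Z
    -- A vertex of `A` has three `a`-neighbours in `S`, one of them outside `R`; both ends of that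
    -- edge are in `Z` and are not adjacent in `b`.
    ¬clique cl with pick A ⊥ (≤-<-trans (≤-reflexive (∣⊥∣≡0 n)) (≤-trans (s≤s z≤n) (3≤∣A∣ s)))
    ... | x , x∈A , _ with pick (nbhd a S x) R (≤-<-trans R≤2 (proj₁ r (A⊆S s x∈A)))
    ...   | y , i , y∉R with trans (sym (proj₁ (∈nbhd⁻ a i)))
                              (true⇒false (cl x y (∁R⊆Z (x∉p⇒x∈∁p (A∌ s x∈A))) (∁R⊆Z (x∉p⇒x∈∁p y∉R))
                                (a⇒≢ a simpleˡ (proj₁ (∈nbhd⁻ a i)))))
    ...     | ()
    connected : ∀ Q → Q ⊆ Z → ∣ Q ∣ ≤ 2 → ConnectedOn b (Z ─ Q)
    connected Q Q⊆Z Q≤2 = uncut⇒connected b λ C cutC →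
      -- Robustness of `Z` gives each side of a cut of `b` at least three vertices, so `one-sided`
      -- refutes either position of `x`.
      let x , x∈A , x∉Q = pick A Q (≤-<-trans Q≤2 (3≤∣A∣ s))
          sZ = sides (Complementary-sym compl) rZ Q≤2 cutC
          Z─Q⊆ = λ {y} i → [ (λ j → ⊥-elim (x∈p─q⇒x∉q Z Q i j)) , id ]′ (S⊆ sZ {y} (p─q⊆p Z Q i))
      in [ (λ x∈C → one-sided ⊤⟶S R⊆S R≤2 ∁R⊆Z Q≤2 s Z─Q⊆ (across sZ) x∈A x∈C (3≤∣B∣ sZ) (p─q⊆p (Z ─ Q) C))
         , (λ x∈D → one-sided ⊤⟶S R⊆S R≤2 ∁R⊆Z Q≤2 s (swap ∘ Z─Q⊆) (λ i j → a-sym b simpleʳ (across sZ j i))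
                      x∈A x∈D (3≤∣A∣ sZ) (Cut.C⊆T cutC))
         ]′ (Z─Q⊆ (x∈p∧x∉q⇒x∈p─q (∁R⊆Z (x∉p⇒x∈∁p (A∌ s x∈A))) x∉Q))

-- Counting the edges between `L` and the remaining vertices.

∣p∣≡∣p∩∁q∣+∣p∩q∣ : (p q : Subset n) → ∣ p ∣ ≡ ∣ p ∩ ∁ q ∣ + ∣ p ∩ q ∣
∣p∣≡∣p∩∁q∣+∣p∩q∣ p q = ≤-antisym (∣∣-cover p (p ∩ ∁ q) (p ∩ q) split)
  (∣∣-disjoint (p ∩ ∁ q) (p ∩ q) p (p∩q⊆p p (∁ q)) (p∩q⊆p p q)
    λ i j → x∈∁p⇒x∉p (p∩q⊆q p (∁ q) i) (p∩q⊆q p q j))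
  where
  split : ∀ {x} → x ∈ p → x ∈ p ∩ ∁ q ⊎ x ∈ p ∩ q
  split {x} i with x ∈? q
  ... | yes j = inj₂ (x∈p∩q⁺ (i , j))
  ... | no j  = inj₁ (x∈p∩q⁺ (i , x∉p⇒x∈∁p j))

p-x∩q≡p∩q-x : (p q : Subset n) (x : Fin n) → (p - x) ∩ q ≡ p ∩ q - x
p-x∩q≡p∩q-x p q x = ⊆-antisym
  (λ i → let j , k = x∈p∩q⁻ (p - x) q i
         in x∈p∧x≢y⇒x∈p-y (x∈p∩q⁺ (p─q⊆p p ⁅ x ⁆ j , k)) (x∈p-y⇒x≢y p j))
  (λ i → let j , k = x∈p∩q⁻ p q (p─q⊆p (p ∩ q) ⁅ x ⁆ i)
         in x∈p∩q⁺ (x∈p∧x≢y⇒x∈p-y j (x∈p-y⇒x≢y (p ∩ q) i) , k))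

p-x∩q≡p∩q : (p q : Subset n) {x : Fin n} → x ∉ q → (p - x) ∩ q ≡ p ∩ q
p-x∩q≡p∩q p q {x} x∉q = ⊆-antisym
  (λ i → let j , k = x∈p∩q⁻ (p - x) q i in x∈p∩q⁺ (p─q⊆p p ⁅ x ⁆ j , k))
  (λ i → let j , k = x∈p∩q⁻ p q i in x∈p∩q⁺ (x∈p∧x≢y⇒x∈p-y j (∈∧∉⇒≢ k x∉q) , k))

-- Reads `x - 2s ≤ y - 2s′`, kept free of subtraction: deleting `d` vertices costs at most `2d`.
rebalance : ∀ d {x y s s′} → s ≡ d + s′ → x ≤ 2 * d + y → x + 2 * s′ ≤ y + 2 * s
rebalance d {y = y} {s′ = s′} refl x≤ = ≤-trans (+-monoˡ-≤ (2 * s′) x≤) (≤-reflexive (arith d y s′))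
  where
  arith : ∀ d y s′ → 2 * d + y + 2 * s′ ≡ y + 2 * (d + s′)
  arith = solve-∀

-- Over the integers this is `(p - 2)(q - 2) ≤ 0`: a sum of at least three excludes two negative
-- factors, a sum of at most four two positive ones.
p*q+4≤2*[p+q] : ∀ p q → 3 ≤ p + q → p + q ≤ 4 → p * q + 4 ≤ 2 * (p + q)
p*q+4≤2*[p+q] 0 3 _ _ = m≤m+n _ _
p*q+4≤2*[p+q] 0 4 _ _ = m≤m+n _ _
p*q+4≤2*[p+q] 1 2 _ _ = m≤m+n _ _
p*q+4≤2*[p+q] 1 3 _ _ = m≤m+n _ _
p*q+4≤2*[p+q] 2 1 _ _ = m≤m+n _ _
p*q+4≤2*[p+q] 2 2 _ _ = m≤m+n _ _
p*q+4≤2*[p+q] 3 0 _ _ = m≤m+n _ _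
p*q+4≤2*[p+q] 3 1 _ _ = m≤m+n _ _
p*q+4≤2*[p+q] 4 0 _ _ = m≤m+n _ _
p*q+4≤2*[p+q] 0 0 () _
p*q+4≤2*[p+q] 0 1 (s≤s ()) _
p*q+4≤2*[p+q] 0 2 (s≤s (s≤s ())) _
p*q+4≤2*[p+q] 1 0 (s≤s ()) _
p*q+4≤2*[p+q] 1 1 (s≤s (s≤s ())) _
p*q+4≤2*[p+q] 2 0 (s≤s (s≤s ())) _
p*q+4≤2*[p+q] 0 (suc (suc (suc (suc (suc q))))) _ (s≤s (s≤s (s≤s (s≤s ()))))
p*q+4≤2*[p+q] 1 (suc (suc (suc (suc q)))) _ (s≤s (s≤s (s≤s (s≤s ()))))
p*q+4≤2*[p+q] 2 (suc (suc (suc q))) _ (s≤s (s≤s (s≤s (s≤s ()))))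
p*q+4≤2*[p+q] 3 (suc (suc q)) _ (s≤s (s≤s (s≤s (s≤s ()))))
p*q+4≤2*[p+q] 4 (suc q) _ (s≤s (s≤s (s≤s (s≤s ()))))
p*q+4≤2*[p+q] (suc (suc (suc (suc (suc p))))) q _ (s≤s (s≤s (s≤s (s≤s ()))))

-- With `m = 3 + j` and `l = 5 + k`, the inequality `m(l - 2) + 4 ≤ 2(m + l)` amounts to
-- `(m - 2)(l - 4) ≤ 4`, that is `j + k + jk ≤ 3`, whereas twelve vertices force `j + k ≥ 4`.
crossing-count : ∀ j k → 12 ≤ (3 + j) + (5 + k) → ¬ ((3 + j) * (3 + k) + 4 ≤ 2 * ((3 + j) + (5 + k)))
crossing-count j k 12≤ le = <⇒≱ 4≤j+k (+-cancelˡ-≤ (13 + 2 * (j + k)) _ _ (begin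
    13 + 2 * (j + k) + (j + k)               ≤⟨ m≤m+n _ (j * k) ⟩
    13 + 2 * (j + k) + (j + k) + j * k       ≡⟨ lhs j k ⟩
    (3 + j) * (3 + k) + 4                    ≤⟨ le ⟩
    2 * ((3 + j) + (5 + k))                  ≡⟨ rhs j k ⟩
    13 + 2 * (j + k) + 3                     ∎))
  where
  open ≤-Reasoning
  lhs : ∀ j k → 13 + 2 * (j + k) + (j + k) + j * k ≡ (3 + j) * (3 + k) + 4
  lhs = solve-∀
  rhs : ∀ j k → 2 * ((3 + j) + (5 + k)) ≡ 13 + 2 * (j + k) + 3
  rhs = solve-∀
  sum : ∀ j k → (3 + j) + (5 + k) ≡ 8 + (j + k)
  sum = solve-∀
  4≤j+k : 4 ≤ j + k
  4≤j+k = +-cancelˡ-≤ 8 _ _ (subst (12 ≤_) (sum j k) 12≤)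

module _ (a : Adj n) (L : Subset n) where

  -- Edges inside `T` with exactly one end in `L`, counted at the end outside `L`.
  crossEdges : Subset n → ℕ
  crossEdges T = ∑∈ (T ∩ ∁ L) (deg a (T ∩ L))

  deg-delete : ∀ {T v} → v ∈ T → ∀ i → deg a T i ≡ χ (a i v) + deg a (T - v) i
  deg-delete {T} {v} v∈T i = trans (sym (∑∈-χ T (a i)))
    (trans (∑∈-delete T (χ ∘ a i) v∈T) (cong (χ (a i v) +_) (∑∈-χ (T - v) (a i))))

  module _ (simple : IsSimpleGraph a) where

    crossEdges-delete : ∀ {T v} → v ∈ T → v ∉ L → crossEdges T ≡ deg a (T ∩ L) v + crossEdges (T - v)
    crossEdges-delete {T} {v} v∈T v∉L = trans
      (∑∈-delete (T ∩ ∁ L) (deg a (T ∩ L)) (x∈p∩q⁺ (v∈T , x∉p⇒x∈∁p v∉L)))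
      (cong (deg a (T ∩ L) v +_) (sym
        (cong₂ (λ p q → ∑∈ p (deg a q)) (p-x∩q≡p∩q-x T (∁ L) v) (p-x∩q≡p∩q T L v∉L))))

    -- Here `v` is not an index of the sum but is counted within its terms: each loses `χ (a i v)`,
    -- and by symmetry these losses add up to a degree of `v`.
    crossEdges-delete′ : ∀ {T v} → v ∈ T → v ∈ L → crossEdges T ≡ deg a (T ∩ ∁ L) v + crossEdges (T - v)
    crossEdges-delete′ {T} {v} v∈T v∈L = begin
      ∑∈ (T ∩ ∁ L) (deg a (T ∩ L))
        ≡⟨ ∑∈-cong (T ∩ ∁ L) (λ i → trans (deg-delete (x∈p∩q⁺ (v∈T , v∈L)) i)
             (cong (λ c → χ c + deg a (T ∩ L - v) i) (proj₁ simple i v))) ⟩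
      ∑∈ (T ∩ ∁ L) (λ i → χ (a v i) + deg a (T ∩ L - v) i)
        ≡⟨ ∑∈-+ (T ∩ ∁ L) (χ ∘ a v) (deg a (T ∩ L - v)) ⟩
      ∑∈ (T ∩ ∁ L) (χ ∘ a v) + ∑∈ (T ∩ ∁ L) (deg a (T ∩ L - v))
        ≡⟨ cong₂ _+_ (∑∈-χ (T ∩ ∁ L) (a v)) (cong₂ (λ p q → ∑∈ p (deg a q))
             (sym (p-x∩q≡p∩q T (∁ L) (x∈p⇒x∉∁p v∈L))) (sym (p-x∩q≡p∩q-x T L v))) ⟩
      deg a (T ∩ ∁ L) v + crossEdges (T - v) ∎
      where open ≡-Reasoning

    -- `X` plays the side opposite to both vertices. Since `u` and `v` use up two places of
    -- `N[u] ∪ N[v]`, each has at most two neighbours in `X`.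
    same-side : ∀ {S S' u v} X → S' ⊆ S → u ∉ X → v ∉ X → u ≢ v → ∣ cpair a S u v ∣ ≤ 4 →
      deg a (S ∩ X) u + deg a (S' ∩ X) v ≤ 4
    same-side {S} {S'} {u} {v} X S'⊆S u∉X v∉X u≢v le = +-mono-≤
      (pair-outside a u≢v le (nbhdˡ a S u v ∘ nbhd-mono a (p∩q⊆p S X) u) (avoids u∉X) (avoids v∉X))
      (pair-outside a u≢v le (nbhdʳ a S u v ∘ nbhd-mono a (S'⊆S ∘ p∩q⊆p S' X) v) (avoids u∉X) (avoids v∉X))
      where
      avoids : ∀ {T w z} → w ∉ X → w ∉ nbhd a (T ∩ X) z
      avoids {T} w∉X i = w∉X (p∩q⊆q T X (proj₂ (∈nbhd⁻ a i)))

    -- The two neighbour sets lie on different sides, so they are disjoint parts of `N[u] ∪ N[v]`.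
    opposite-sides : ∀ {S S' u v} X Y → S' ⊆ S → (∀ {x} → x ∈ X → x ∉ Y) → ∣ cpair a S u v ∣ ≤ 4 →
      deg a (S ∩ X) u + deg a (S' ∩ Y) v ≤ 4
    opposite-sides {S} {S'} {u} {v} X Y S'⊆S X∌Y le = ≤-trans
      (∣∣-disjoint (nbhd a (S ∩ X) u) (nbhd a (S' ∩ Y) v) (cpair a S u v)
        (nbhdˡ a S u v ∘ nbhd-mono a (p∩q⊆p S X) u)
        (nbhdʳ a S u v ∘ nbhd-mono a (S'⊆S ∘ p∩q⊆p S' Y) v)
        (λ i j → X∌Y (p∩q⊆q S X (proj₂ (∈nbhd⁻ a i))) (p∩q⊆q S' Y (proj₂ (∈nbhd⁻ a j))))) le

    delv-crossEdges : ∀ {S v} → v ∈ S → deg a S v ≤ 2 → crossEdges S ≤ 2 + crossEdges (S - v)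
    delv-crossEdges {S} {v} v∈S le with v ∈? L
    ... | yes v∈L = ≤-trans (≤-reflexive (crossEdges-delete′ v∈S v∈L)) (+-monoˡ-≤ _
            (≤-trans (p⊆q⇒∣p∣≤∣q∣ (nbhd-mono a (p∩q⊆p S (∁ L)) v)) le))
    ... | no v∉L = ≤-trans (≤-reflexive (crossEdges-delete v∈S v∉L)) (+-monoˡ-≤ _
            (≤-trans (p⊆q⇒∣p∣≤∣q∣ (nbhd-mono a (p∩q⊆p S L) v)) le))

    delp-crossEdges : ∀ {S u v} → u ∈ S → v ∈ S → u ≢ v → ∣ cpair a S u v ∣ ≤ 4 →
      crossEdges S ≤ 4 + crossEdges (S - u - v)
    delp-crossEdges {S} {u} {v} u∈S v∈S u≢v le = bound
      where
      v∈S-u = x∈p∧x≢y⇒x∈p-y v∈S (u≢v ∘ sym)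
      S-u⊆S = p─q⊆p S ⁅ u ⁆
      twice : ∀ {k l m p q} → k ≡ p + l → l ≡ q + m → p + q ≤ 4 → k ≤ 4 + m
      twice {p = p} {q} refl refl p+q≤4 = ≤-trans (≤-reflexive (sym (+-assoc p q _))) (+-monoˡ-≤ _ p+q≤4)
      bound : crossEdges S ≤ 4 + crossEdges (S - u - v)
      bound with u ∈? L | v ∈? L
      ... | yes i | yes j = twice (crossEdges-delete′ u∈S i) (crossEdges-delete′ v∈S-u j)
              (same-side (∁ L) S-u⊆S (x∈p⇒x∉∁p i) (x∈p⇒x∉∁p j) u≢v le)
      ... | yes i | no j  = twice (crossEdges-delete′ u∈S i) (crossEdges-delete v∈S-u j)
              (opposite-sides (∁ L) L S-u⊆S x∈∁p⇒x∉p le)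
      ... | no i  | yes j = twice (crossEdges-delete u∈S i) (crossEdges-delete′ v∈S-u j)
              (opposite-sides L (∁ L) S-u⊆S x∈p⇒x∉∁p le)
      ... | no i  | no j  = twice (crossEdges-delete u∈S i) (crossEdges-delete v∈S-u j)
              (same-side L S-u⊆S i j u≢v le)

    -- The potential `crossEdges S - 2 ∣ S ∣` never decreases along a reduction: on average a
    -- deleted vertex takes at most two crossing edges with it.
    crossEdges-step : ∀ {S S'} → Step3* a S S' → crossEdges S + 2 * ∣ S' ∣ ≤ crossEdges S' + 2 * ∣ S ∣
    crossEdges-step {S} (delv v v∈S le) =
      rebalance 1 (∣p∣≡1+∣p-x∣ v∈S) (delv-crossEdges v∈S le)
    crossEdges-step {S} (delp u v u∈S v∈S u≢v le) =
      rebalance 2 (∣p∣≡2+∣p-x-y∣ u∈S v∈S u≢v) (delp-crossEdges u∈S v∈S u≢v le)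

    crossEdges≤ : ∀ T → crossEdges T ≤ ∣ T ∩ ∁ L ∣ * ∣ T ∩ L ∣
    crossEdges≤ T = ≤-trans (∑∈-mono (T ∩ ∁ L) λ {i} _ → ∣p∩q∣≤∣q∣ (tabulate (a i)) (T ∩ L))
      (≤-reflexive (∑∈-const (T ∩ ∁ L) ∣ T ∩ L ∣))

    crossEdges-small : ∀ T → 3 ≤ ∣ T ∣ → ∣ T ∣ ≤ 4 → crossEdges T + 4 ≤ 2 * ∣ T ∣
    crossEdges-small T 3≤ ≤4 = ≤-trans (+-monoˡ-≤ 4 (crossEdges≤ T))
      (subst (λ t → ∣ T ∩ ∁ L ∣ * ∣ T ∩ L ∣ + 4 ≤ 2 * t) (sym eq)
        (p*q+4≤2*[p+q] ∣ T ∩ ∁ L ∣ ∣ T ∩ L ∣ (subst (3 ≤_) eq 3≤) (subst (_≤ 4) eq ≤4)))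
      where eq = ∣p∣≡∣p∩∁q∣+∣p∩q∣ T L

    -- The potential is at most its value where the induction stops. The gain of `4` comes from
    -- stopping at three or four vertices, or from `base` if the reduction itself ends earlier.
    crossEdges-bound : ∀ {S T} → Star (Step3* a) S T → (3 ≤ ∣ T ∣ → crossEdges T + 4 ≤ 2 * ∣ T ∣) →
      3 ≤ ∣ S ∣ → crossEdges S + 4 ≤ 2 * ∣ S ∣
    crossEdges-bound ε base 3≤ = base 3≤
    crossEdges-bound {S} (_◅_ {j = S'} s ss) base 3≤ with 3 ≤? ∣ S' ∣
    -- The next set has at most two vertices, so `S` has three or four, and the product of its two
    -- side sizes is a good enough bound.
    ... | no ¬3≤ = crossEdges-small S 3≤ (≤-trans (step-size a s) (+-monoʳ-≤ 2 (s≤s⁻¹ (≰⇒> ¬3≤))))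
    ... | yes 3≤' = +-cancelʳ-≤ (2 * ∣ S' ∣) _ _ (begin
      crossEdges S + 4 + 2 * ∣ S' ∣    ≡⟨ xy∙z≈xz∙y (crossEdges S) 4 (2 * ∣ S' ∣) ⟩
      crossEdges S + 2 * ∣ S' ∣ + 4    ≤⟨ +-monoˡ-≤ 4 (crossEdges-step s) ⟩
      crossEdges S' + 2 * ∣ S ∣ + 4    ≡⟨ xy∙z≈xz∙y (crossEdges S') (2 * ∣ S ∣) 4 ⟩
      crossEdges S' + 4 + 2 * ∣ S ∣    ≤⟨ +-monoˡ-≤ (2 * ∣ S ∣) (crossEdges-bound ss base 3≤') ⟩
      2 * ∣ S' ∣ + 2 * ∣ S ∣           ≡⟨ +-comm (2 * ∣ S' ∣) _ ⟩
      2 * ∣ S ∣ + 2 * ∣ S' ∣           ∎)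
      where
      open ≤-Reasoning

-- Crossing edges when `L` arises from reducing the complement.

module _ {a b : Adj n} (compl : Complementary a b) where
  open Complementary compl

  -- A vertex of `L` that is not an `a`-neighbour of the removed vertex `v` is one of its at most
  -- two `b`-neighbours in `L`.
  missing≤2 : ∀ {L v} → Star (Step3* b) ⊤ L → v ∉ L → ∣ L ∣ ≤ 2 + deg a L v
  missing≤2 {L} {v} ⊤⟶L v∉L = ≤-trans
    (∣∣-cover L (nbhd b L v) (nbhd a L v) λ i → swap (nbr-⊎ i (∈∧∉⇒≢ i v∉L)))
    (+-monoˡ-≤ _ (removed-deg b ⊤⟶L ∈⊤ v∉L))

  crossEdges≥ : ∀ {L} → Star (Step3* b) ⊤ L → ∀ {k} → ∣ L ∣ ≡ 2 + k → ∣ ∁ L ∣ * k ≤ crossEdges a L ⊤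
  crossEdges≥ {L} ⊤⟶L {k} eq = begin
    ∣ ∁ L ∣ * k                      ≡⟨ cong (λ p → ∣ p ∣ * k) (∩-identityˡ (∁ L)) ⟨
    ∣ ⊤ ∩ ∁ L ∣ * k                  ≡⟨ ∑∈-const (⊤ ∩ ∁ L) k ⟨
    ∑∈ (⊤ ∩ ∁ L) (λ _ → k)           ≤⟨ ∑∈-mono (⊤ ∩ ∁ L) (λ {i} i∈ → s≤s⁻¹ (s≤s⁻¹ (subst₂ (λ l p → l ≤ 2 + deg a p i) eq
                                          (sym (∩-identityˡ L)) (missing≤2 ⊤⟶L (x∈∁p⇒x∉p (p∩q⊆q ⊤ (∁ L) i∈)))))) ⟩
    crossEdges a L ⊤                 ∎
    where open ≤-Reasoning

  -- Double counting: the reduction of `b` bounds the crossing edges of `a` from below by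
  -- `crossEdges≥`, the reduction of `a` bounds them from above by `crossEdges-bound`.
  ∣∁L∣≤2 : ∀ {L T} → 12 ≤ n → Star (Step3* b) ⊤ L → 5 ≤ ∣ L ∣ → Star (Step3* a) ⊤ T →
    (3 ≤ ∣ T ∣ → crossEdges a L T + 4 ≤ 2 * ∣ T ∣) → ∣ ∁ L ∣ ≤ 2
  ∣∁L∣≤2 {L} 12≤n ⊤⟶L 5≤L ⊤⟶T base = ≮⇒≥ λ 3≤∁L →
    let k , L≡ = m≤n⇒∃[o]m+o≡n 5≤L
        j , M≡ = m≤n⇒∃[o]m+o≡n 3≤∁L
        n≡ : ∣ ⊤ {n} ∣ ≡ (3 + j) + (5 + k)
        n≡ = trans (∣p∣≡∣p∩∁q∣+∣p∩q∣ ⊤ L)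
               (cong₂ _+_ (trans (cong ∣_∣ (∩-identityˡ (∁ L))) (sym M≡)) (trans (cong ∣_∣ (∩-identityˡ L)) (sym L≡)))
    in crossing-count j k (subst (12 ≤_) (trans (sym (∣⊤∣≡n n)) n≡) 12≤n)
      (≤-trans (+-monoˡ-≤ 4 (subst (λ m → m * (3 + k) ≤ crossEdges a L ⊤) (sym M≡) (crossEdges≥ ⊤⟶L (sym L≡))))
        (subst (λ m → crossEdges a L ⊤ + 4 ≤ 2 * m) n≡
          (crossEdges-bound a L simpleˡ ⊤⟶T base (subst (3 ≤_) (sym (∣⊤∣≡n n)) (≤-trans (m≤m+n 3 9) 12≤n)))))

  -- An a-clique and a b-clique share at most one vertex.
  crossEdges-clique : ∀ {L T} → CliqueOn a T → CliqueOn b L → 5 ≤ ∣ T ∣ → crossEdges a L T + 4 ≤ 2 * ∣ T ∣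
  crossEdges-clique {L} {T} clT clL 5≤T = begin
    crossEdges a L T + 4                ≤⟨ +-monoˡ-≤ 4 (crossEdges≤ a L simpleˡ T) ⟩
    ∣ T ∩ ∁ L ∣ * ∣ T ∩ L ∣ + 4         ≤⟨ +-mono-≤ (*-mono-≤ (∣p∩q∣≤∣p∣ T (∁ L)) ∣T∩L∣≤1) (≤-trans (n≤1+n 4) 5≤T) ⟩
    ∣ T ∣ * 1 + ∣ T ∣                   ≡⟨ cong₂ _+_ (*-identityʳ ∣ T ∣) (sym (+-identityʳ ∣ T ∣)) ⟩
    2 * ∣ T ∣                           ∎
    where
    open ≤-Reasoning
    ∣T∩L∣≤1 : ∣ T ∩ L ∣ ≤ 1
    ∣T∩L∣≤1 = ≮⇒≥ λ 1< →
      let x , x∈ , _ = pick (T ∩ L) ⊥ (≤-<-trans (≤-reflexive (∣⊥∣≡0 n)) (<-trans (s≤s z≤n) 1<))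
          y , y∈ , y∉ = pick (T ∩ L) ⁅ x ⁆ (≤-<-trans (≤-reflexive (∣⁅x⁆∣≡1 x)) 1<)
          x≢y = λ e → y∉ (subst (_∈ ⁅ x ⁆) e (x∈⁅x⁆ x))
          absurd = trans (sym (clT x y (p∩q⊆p T L x∈) (p∩q⊆p T L y∈) x≢y))
                     (true⇒false (clL x y (p∩q⊆q T L x∈) (p∩q⊆q T L y∈) x≢y))
      in B.not-¬ absurd refl

-- Small sets, stars as forests, and stripping down to a 2-core.

data AtMostTwo (p : Subset n) : Set where
  none : Empty p → AtMostTwo p
  one  : ∀ x → x ∈ p → (∀ {z} → z ∈ p → z ≡ x) → AtMostTwo p
  two  : ∀ x y → x ≢ y → x ∈ p → y ∈ p → (∀ {z} → z ∈ p → z ≡ x ⊎ z ≡ y) → AtMostTwo p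

atMostTwo : (p : Subset n) → ∣ p ∣ ≤ 2 → AtMostTwo p
atMostTwo p ≤2 with nonempty? p
... | no e = none e
... | yes (x , x∈p) with nonempty? (p - x)
...   | no e = one x x∈p λ {z} z∈p → decidable-stable (z ≟ x) λ z≢x → e (z , x∈p∧x≢y⇒x∈p-y z∈p z≢x)
...   | yes (y , y∈p-x) = two x y x≢y x∈p y∈p only
  where
  y∈p = p─q⊆p p ⁅ x ⁆ y∈p-x
  x≢y = x∈p-y⇒x≢y p y∈p-x ∘ sym
  only : ∀ {z} → z ∈ p → z ≡ x ⊎ z ≡ y
  only {z} z∈p with z ≟ x | z ≟ y
  ... | yes e  | _      = inj₁ e
  ... | no _   | yes e  = inj₂ e
  ... | no z≢x | no z≢y = ⊥-elim (<⇒≱ (0<∣p∣ (x∈p∧x≢y⇒x∈p-y (x∈p∧x≢y⇒x∈p-y z∈p z≢x) z≢y))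
    (s≤s⁻¹ (s≤s⁻¹ (subst (_≤ 2) (∣p∣≡2+∣p-x-y∣ x∈p y∈p x≢y) ≤2))))

module _ (a : Adj n) where

  -- Every vertex of a cycle is missed by some edge of the cycle, but here every edge contains `x`.
  covered⇒Forest : ∀ x → (∀ {u v} → a u v ≡ true → u ≡ x ⊎ v ≡ x) → Forest a
  covered⇒Forest x covers k (f , inj , path , close) = [ first , second k f inj path close ]′ (covers (path zero))
    where
    clash : ∀ {k} {f : Fin (3 + k) → Fin n} {i j} → Injective _≡_ _≡_ f → i ≢ j → f i ≡ x → f j ≡ x → Absurd
    clash inj i≢j e e′ = i≢j (inj (trans e (sym e′)))
    first : f zero ≡ x → Absurd
    first e = [ clash inj (λ ()) e , clash inj (λ ()) e ]′ (covers (path (suc zero)))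
    second : ∀ k (f : Fin (3 + k) → Fin n) → Injective _≡_ _≡_ f →
      (∀ i → a (f (inject₁ i)) (f (suc i)) ≡ true) → a (f (fromℕ (2 + k))) (f zero) ≡ true →
      f (suc zero) ≡ x → Absurd
    -- In a triangle the edge avoiding vertex 1 is the closing one; in a longer cycle the edge from
    -- 2 to 3 serves.
    second zero    f inj path close e = [ clash inj (λ ()) e , clash inj (λ ()) e ]′ (covers close)
    second (suc k) f inj path close e = [ clash inj (λ ()) e , clash inj (λ ()) e ]′ (covers (path (suc (suc zero))))

  -- Vertices outside `S` have degree at most one already in the whole graph, so they can be deleted
  -- in any order. `k` bounds `∣ T ∣`.
  strip : ∀ {S} → (∀ {v} → v ∉ S → deg a ⊤ v ≤ 1) → ∀ k T → ∣ T ∣ ≤ k → S ⊆ T → Star (Step2 a) T S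
  strip {S} low k T le S⊆T with nonempty? (T ─ S)
  ... | no e = subst (Star (Step2 a) T) (⊆-antisym T⊆S S⊆T) ε
    where
    T⊆S : T ⊆ S
    T⊆S {z} z∈T = decidable-stable (z ∈? S) λ z∉S → e (z , x∈p∧x∉q⇒x∈p─q z∈T z∉S)
  strip {S} low zero T le S⊆T | yes (v , i) = ⊥-elim (<⇒≱ (0<∣p∣ (p─q⊆p T S i)) le)
  strip {S} low (suc k) T le S⊆T | yes (v , i) =
    del v v∈T (s≤s (≤-trans (p⊆q⇒∣p∣≤∣q∣ (nbhd-mono a ⊆⊤ v)) (low v∉S)))
    ◅ strip low k (T - v) (s≤s⁻¹ (≤-trans (x∈p⇒∣p-x∣<∣p∣ v∈T) le)) (λ j → x∈p∧x≢y⇒x∈p-y (S⊆T j) (∈∧∉⇒≢ j v∉S))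
    where
    v∈T = p─q⊆p T S i
    v∉S = x∈p─q⇒x∉q T S i

-- A clique of the complement that misses at most two vertices.

module _ {a b : Adj n} (compl : Complementary a b) where
  open Complementary compl

  module _ {L : Subset n} (12≤n : 12 ≤ n) (⊤⟶L : Star (Step3* b) ⊤ L) (clL : CliqueOn b L) (∁L≤2 : ∣ ∁ L ∣ ≤ 2) where

    independent : ∀ {u v} → u ∈ L → v ∈ L → a u v ≡ false
    independent {u} {v} i j with u ≟ v
    ... | yes refl = proj₂ simpleˡ u
    ... | no u≢v = true⇒false (clL u v i j u≢v)

    nbr∉L : ∀ {u v} → u ∈ L → a u v ≡ true → v ∉ L
    nbr∉L i e j = B.not-¬ (trans (sym e) (independent i j)) refl

    10≤∣L∣ : 10 ≤ ∣ L ∣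
    10≤∣L∣ = +-cancelˡ-≤ 2 _ _ (begin
      12                                ≤⟨ 12≤n ⟩
      n                                 ≡⟨ ∣⊤∣≡n n ⟨
      ∣ ⊤ {n} ∣                         ≤⟨ ∣∣-cover ⊤ (∁ L) L (λ {x} _ → split x) ⟩
      ∣ ∁ L ∣ + ∣ L ∣                   ≤⟨ +-monoˡ-≤ ∣ L ∣ ∁L≤2 ⟩
      2 + ∣ L ∣                         ∎)
      where
      open ≤-Reasoning
      split : ∀ x → x ∈ ∁ L ⊎ x ∈ L
      split x with x ∈? L
      ... | yes i = inj₂ i
      ... | no i  = inj₁ (x∉p⇒x∈∁p i)

    8≤deg : ∀ {v} → v ∉ L → 8 ≤ deg a L v
    8≤deg v∉L = +-cancelˡ-≤ 2 _ _ (≤-trans 10≤∣L∣ (missing≤2 compl ⊤⟶L v∉L))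

    -- `L` is independent in `a`, so all edges of `a` meet `x`: it has degree at least eight, every
    -- other vertex at most one.
    star⇒Good : ∀ x → x ∉ L → (∀ {z} → z ∉ L → z ≡ x) → Good a
    star⇒Good x x∉L only = inj₂ (inj₁ (covered⇒Forest a x covers , x , λ w w≢x → begin-strict
        deg a ⊤ w   ≤⟨ p⊆q⇒∣p∣≤∣q∣ (λ i → subst (_∈ ⁅ x ⁆) (sym (only (nbr∉L (∈L w≢x) (proj₁ (∈nbhd⁻ a i))))) (x∈⁅x⁆ x)) ⟩
        ∣ ⁅ x ⁆ ∣   ≡⟨ ∣⁅x⁆∣≡1 x ⟩
        1           <⟨ s≤s (s≤s z≤n) ⟩
        8           ≤⟨ 8≤deg x∉L ⟩
        deg a L x   ≤⟨ p⊆q⇒∣p∣≤∣q∣ (nbhd-mono a ⊆⊤ x) ⟩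
        deg a ⊤ x   ∎))
      where
      open ≤-Reasoning
      ∈L : ∀ {w} → w ≢ x → w ∈ L
      ∈L {w} w≢x = decidable-stable (w ∈? L) (w≢x ∘ only)
      covers : ∀ {u v} → a u v ≡ true → u ≡ x ⊎ v ≡ x
      covers {u} {v} e with u ≟ x
      ... | yes u≡x = inj₁ u≡x
      ... | no u≢x  = inj₂ (only (nbr∉L (∈L u≢x) e))

    module _ {x y : Fin n} (x≢y : x ≢ y) (x∉L : x ∉ L) (y∉L : y ∉ L) (only : ∀ {z} → z ∉ L → z ≡ x ⊎ z ≡ y) where

      common : Subset n
      common = nbhd a (nbhd a L x) y

      ∈common⁻ : ∀ {z} → z ∈ common → a x z ≡ true × a y z ≡ true × z ∈ L
      ∈common⁻ i with ∈nbhd⁻ a i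
      ... | y~z , j with ∈nbhd⁻ a j
      ...   | x~z , z∈L = x~z , y~z , z∈L

      -- `x` has at least eight neighbours in `L`, and at most two of them fail to be neighbours of
      -- the removed vertex `y`.
      6≤∣common∣ : 6 ≤ ∣ common ∣
      6≤∣common∣ = +-cancelˡ-≤ 2 _ _ (≤-trans (8≤deg x∉L) (≤-trans
        (∣∣-cover (nbhd a L x) (nbhd b L y) common split)
        (+-monoˡ-≤ _ (removed-deg b ⊤⟶L ∈⊤ y∉L))))
        where
        split : ∀ {z} → z ∈ nbhd a L x → z ∈ nbhd b L y ⊎ z ∈ common
        split i with nbr-⊎ i (∈∧∉⇒≢ (proj₂ (∈nbhd⁻ a i)) y∉L)
        ... | inj₁ j = inj₂ j
        ... | inj₂ j = inj₁ (nbhd-mono b (λ k → proj₂ (∈nbhd⁻ a k)) y j)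

      hubs∪common : Subset n
      hubs∪common = ⁅ x ⁆ ∪ (⁅ y ⁆ ∪ common)

      x∈ : x ∈ hubs∪common
      x∈ = x∈p∪q⁺ (inj₁ (x∈⁅x⁆ x))

      y∈ : y ∈ hubs∪common
      y∈ = x∈p∪q⁺ (inj₂ (x∈p∪q⁺ (inj₁ (x∈⁅x⁆ y))))

      common⊆ : common ⊆ hubs∪common
      common⊆ i = x∈p∪q⁺ (inj₂ (x∈p∪q⁺ (inj₂ i)))

      ∈hubs∪common⁻ : ∀ {z} → z ∈ hubs∪common → z ≡ x ⊎ z ≡ y ⊎ z ∈ common
      ∈hubs∪common⁻ i with x∈p∪q⁻ ⁅ x ⁆ _ i
      ... | inj₁ j = inj₁ (x∈⁅y⁆⇒x≡y x j)
      ... | inj₂ j with x∈p∪q⁻ ⁅ y ⁆ _ j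
      ...   | inj₁ k = inj₂ (inj₁ (x∈⁅y⁆⇒x≡y y k))
      ...   | inj₂ k = inj₂ (inj₂ k)

      -- A vertex of `L` has no neighbours besides `x` and `y`, and one adjacent to both would be in
      -- `common`.
      deg≤1 : ∀ {v} → v ∉ hubs∪common → deg a ⊤ v ≤ 1
      deg≤1 {v} v∉ with v ∈? L
      ... | no v∉L = ⊥-elim ([ (λ { refl → v∉ x∈ }) , (λ { refl → v∉ y∈ }) ]′ (only v∉L))
      ... | yes v∈L with a x v in x~v | a y v in y~v
      ...   | true | true = ⊥-elim (v∉ (common⊆ (∈nbhd⁺ a y~v (∈nbhd⁺ a x~v v∈L))))
      ...   | false | _ = ≤-trans (p⊆q⇒∣p∣≤∣q∣ only-y) (≤-reflexive (∣⁅x⁆∣≡1 y))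
        where
        only-y : nbhd a ⊤ v ⊆ ⁅ y ⁆
        only-y {z} i with only (nbr∉L v∈L (proj₁ (∈nbhd⁻ a i)))
        ... | inj₁ refl = ⊥-elim (B.not-¬ (trans (sym (proj₁ (∈nbhd⁻ a i))) (a-sym a simpleˡ x~v)) refl)
        ... | inj₂ refl = x∈⁅x⁆ y
      ...   | true | false = ≤-trans (p⊆q⇒∣p∣≤∣q∣ only-x) (≤-reflexive (∣⁅x⁆∣≡1 x))
        where
        only-x : nbhd a ⊤ v ⊆ ⁅ x ⁆
        only-x {z} i with only (nbr∉L v∈L (proj₁ (∈nbhd⁻ a i)))
        ... | inj₁ refl = x∈⁅x⁆ x
        ... | inj₂ refl = ⊥-elim (B.not-¬ (trans (sym (proj₁ (∈nbhd⁻ a i))) (a-sym a simpleˡ y~v)) refl)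

      2≤deg : ∀ {v} → v ∈ hubs∪common → 2 ≤ deg a hubs∪common v
      2≤deg {v} i with ∈hubs∪common⁻ i
      ... | inj₁ refl = ≤-trans (≤-trans (m≤m+n 2 4) 6≤∣common∣)
              (p⊆q⇒∣p∣≤∣q∣ λ j → ∈nbhd⁺ a (proj₁ (∈common⁻ j)) (common⊆ j))
      ... | inj₂ (inj₁ refl) = ≤-trans (≤-trans (m≤m+n 2 4) 6≤∣common∣)
              (p⊆q⇒∣p∣≤∣q∣ λ j → ∈nbhd⁺ a (proj₁ (proj₂ (∈common⁻ j))) (common⊆ j))
      ... | inj₂ (inj₂ j) with ∈common⁻ j
      ...   | x~v , y~v , _ = subst (λ k → 2 + k ≤ deg a hubs∪common v) (∣⊥∣≡0 n)
              (∣∣-insert₂ ⊥ _ ⊥⊆ (∈nbhd⁺ a (a-sym a simpleˡ x~v) x∈) (∈nbhd⁺ a (a-sym a simpleˡ y~v) y∈) x≢y ∉⊥ ∉⊥)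

      is2Core : Is2Core a hubs∪common
      is2Core = strip a deg≤1 _ ⊤ ≤-refl ⊆⊤ , λ { _ (del v i lt) → <⇒≱ lt (2≤deg i) }

      -- The hubs take the indices 0 and 1, as in `K2` and `K11`.
      label : Fin (2 + ∣ common ∣) → Fin n
      label zero          = x
      label (suc zero)    = y
      label (suc (suc i)) = enumerate common i

      label-common : ∀ i → a x (enumerate common i) ≡ true × a y (enumerate common i) ≡ true × enumerate common i ∈ L
      label-common i = ∈common⁻ (enumerate-∈ common i)

      x≢leaf : ∀ i → x ≢ enumerate common i
      x≢leaf i = a⇒≢ a simpleˡ (proj₁ (label-common i))

      y≢leaf : ∀ i → y ≢ enumerate common i
      y≢leaf i = a⇒≢ a simpleˡ (proj₁ (proj₂ (label-common i)))

      label-injective : Injective _≡_ _≡_ label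
      label-injective {zero}        {zero}        e = refl
      label-injective {zero}        {suc zero}    e = ⊥-elim (x≢y e)
      label-injective {zero}        {suc (suc j)} e = ⊥-elim (x≢leaf j e)
      label-injective {suc zero}    {zero}        e = ⊥-elim (x≢y (sym e))
      label-injective {suc zero}    {suc zero}    e = refl
      label-injective {suc zero}    {suc (suc j)} e = ⊥-elim (y≢leaf j e)
      label-injective {suc (suc i)} {zero}        e = ⊥-elim (x≢leaf i (sym e))
      label-injective {suc (suc i)} {suc zero}    e = ⊥-elim (y≢leaf i (sym e))
      label-injective {suc (suc i)} {suc (suc j)} e = cong (λ k → suc (suc k)) (enumerate-injective common e)

      label-∈ : ∀ i → label i ∈ hubs∪common
      label-∈ zero          = x∈
      label-∈ (suc zero)    = y∈
      label-∈ (suc (suc i)) = common⊆ (enumerate-∈ common i)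

      label-surjective : ∀ v → v ∈ hubs∪common → ∃ λ i → label i ≡ v
      label-surjective v i with ∈hubs∪common⁻ i
      ... | inj₁ refl        = zero , refl
      ... | inj₂ (inj₁ refl) = suc zero , refl
      ... | inj₂ (inj₂ j)    = let k , e = enumerate-surjective common j in suc (suc k) , e

      isoK2 : a x y ≡ false → IsoOn a (K2 ∣ common ∣) hubs∪common
      isoK2 x≁y = label , label-injective , label-∈ , label-surjective , adj
        where
        adj : ∀ i j → a (label i) (label j) ≡ K2 ∣ common ∣ i j
        adj zero          zero          = proj₂ simpleˡ x
        adj zero          (suc zero)    = x≁y
        adj zero          (suc (suc j)) = proj₁ (label-common j)
        adj (suc zero)    zero          = a-sym a simpleˡ x≁y
        adj (suc zero)    (suc zero)    = proj₂ simpleˡ y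
        adj (suc zero)    (suc (suc j)) = proj₁ (proj₂ (label-common j))
        adj (suc (suc i)) zero          = a-sym a simpleˡ (proj₁ (label-common i))
        adj (suc (suc i)) (suc zero)    = a-sym a simpleˡ (proj₁ (proj₂ (label-common i)))
        adj (suc (suc i)) (suc (suc j)) = independent (proj₂ (proj₂ (label-common i))) (proj₂ (proj₂ (label-common j)))

      isoK11 : a x y ≡ true → IsoOn a (K11 ∣ common ∣) hubs∪common
      isoK11 x~y = label , label-injective , label-∈ , label-surjective , adj
        where
        adj : ∀ i j → a (label i) (label j) ≡ K11 ∣ common ∣ i j
        adj zero          zero          = proj₂ simpleˡ x
        adj zero          (suc zero)    = x~y
        adj zero          (suc (suc j)) = proj₁ (label-common j)
        adj (suc zero)    zero          = a-sym a simpleˡ x~y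
        adj (suc zero)    (suc zero)    = proj₂ simpleˡ y
        adj (suc zero)    (suc (suc j)) = proj₁ (proj₂ (label-common j))
        adj (suc (suc i)) zero          = a-sym a simpleˡ (proj₁ (label-common i))
        adj (suc (suc i)) (suc zero)    = a-sym a simpleˡ (proj₁ (proj₂ (label-common i)))
        adj (suc (suc i)) (suc (suc j)) =
          -- For two indices from 2 on, `K11` reduces to a conjunction with `false`.
          trans (independent (proj₂ (proj₂ (label-common i))) (proj₂ (proj₂ (label-common j)))) (sym (∧-zeroʳ _))

      hubs⇒Good : Good a
      hubs⇒Good = inj₂ (inj₂ (inj₁ (hubs∪common , is2Core , ∣ common ∣ , ≤-trans (m≤m+n 3 3) 6≤∣common∣ , iso)))
        where
        iso : IsoOn a (K2 ∣ common ∣) hubs∪common ⊎ IsoOn a (K11 ∣ common ∣) hubs∪common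
        iso with a x y in e
        ... | false = inj₁ (isoK2 e)
        ... | true  = inj₂ (isoK11 e)

    -- Zero, one or two vertices outside `L` lead to (i) for `b`, (ii) for `a` and (iii) for `a`,
    -- respectively.
    almost-all-clique⇒Good : Good a ⊎ Good b
    almost-all-clique⇒Good with atMostTwo (∁ L) ∁L≤2
    ... | none e = inj₂ (inj₁ λ u v _ _ → clL u v (∈L u) (∈L v))
      where
      ∈L : ∀ u → u ∈ L
      ∈L u = x∉∁p⇒x∈p λ i → e (u , i)
    ... | one x i only = inj₁ (star⇒Good x (x∈∁p⇒x∉p i) (only ∘ x∉p⇒x∈∁p))
    ... | two x y x≢y i j only =
      inj₁ (hubs⇒Good x≢y (x∈∁p⇒x∉p i) (x∈∁p⇒x∉p j) (only ∘ x∉p⇒x∈∁p))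

  -- Reductions that end in a clique or in the empty set.

  reach-5-or-6 : ∀ {S T} → Star (Step3* b) S T → 5 ≤ ∣ S ∣ → ∣ T ∣ ≡ 0 →
    ∃ λ L → Star (Step3* b) S L × 5 ≤ ∣ L ∣ × ∣ L ∣ ≤ 6
  reach-5-or-6 ε 5≤ T≡0 = ⊥-elim (<⇒≱ (≤-trans (s≤s z≤n) 5≤) (≤-reflexive T≡0))
  reach-5-or-6 {S} (_◅_ {j = S'} s ss) 5≤ T≡0 with 5 ≤? ∣ S' ∣
  ... | no ¬5≤ = S , ε , 5≤ , ≤-trans (step-size b s) (+-monoʳ-≤ 2 (s≤s⁻¹ (≰⇒> ¬5≤)))
  ... | yes 5≤' = let L , s′ , p , q = reach-5-or-6 ss 5≤' T≡0 in L , s ◅ s′ , p , q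

  core-clique⇒Good : 12 ≤ n → ∀ {L T} → Star (Step3* b) ⊤ L → 5 ≤ ∣ L ∣ → CliqueOn b L →
    Star (Step3* a) ⊤ T → (3 ≤ ∣ T ∣ → crossEdges a L T + 4 ≤ 2 * ∣ T ∣) → Good a ⊎ Good b
  core-clique⇒Good 12≤n ⊤⟶L 5≤L clL ⊤⟶T base =
    almost-all-clique⇒Good 12≤n ⊤⟶L clL (∣∁L∣≤2 compl 12≤n ⊤⟶L 5≤L ⊤⟶T base)

  -- A set of five or six vertices on the way to the empty core would have at most two vertices
  -- outside it, hence `n ≤ 8`.
  ¬both-empty : 12 ≤ n → ∀ {S T} → Star (Step3* a) ⊤ S → Star (Step3* b) ⊤ T → ∣ S ∣ ≡ 0 → ∣ T ∣ ≢ 0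
  ¬both-empty 12≤n ⊤⟶S ⊤⟶T S≡0 T≡0 =
    let 5≤n = subst (5 ≤_) (sym (∣⊤∣≡n n)) (≤-trans (m≤m+n 5 7) 12≤n)
        L , ⊤⟶L , 5≤L , L≤6 = reach-5-or-6 ⊤⟶T 5≤n T≡0
        ∁L≤2 = ∣∁L∣≤2 compl 12≤n ⊤⟶L 5≤L ⊤⟶S (λ 3≤ → ⊥-elim (<⇒≱ (≤-trans (s≤s z≤n) 3≤) (≤-reflexive S≡0)))
    in <⇒≱ (≤-trans (m≤m+n 9 3) 12≤n) (begin
      n                   ≡⟨ ∣⊤∣≡n n ⟨
      ∣ ⊤ {n} ∣           ≡⟨ cong ∣_∣ (p∪∁p≡⊤ L) ⟨
      ∣ L ∪ ∁ L ∣         ≤⟨ ∣∣-cover (L ∪ ∁ L) L (∁ L) (x∈p∪q⁻ L (∁ L)) ⟩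
      ∣ L ∣ + ∣ ∁ L ∣     ≤⟨ +-mono-≤ L≤6 ∁L≤2 ⟩
      8                   ∎)
    where open ≤-Reasoning

-- A separated core settles the other graph and a good core its own. In the remaining cases a clique
-- core supplies `L`, and the other core, empty or a clique, supplies the base of the count.
Complementary⇒Good : {a b : Adj n} → Complementary a b → 12 ≤ n → Good a ⊎ Good b
Complementary⇒Good {a = a} {b} compl 12≤n
  with core a | core b
... | S , ⊤⟶S , rS | T , ⊤⟶T , rT
  with coreShape a (Complementary.simpleˡ compl) rS | coreShape b (Complementary.simpleʳ compl) rT
... | separated R c | _             = inj₂ (separated⇒Good compl ⊤⟶S rS c)
... | _             | separated R c = inj₁ (separated⇒Good (Complementary-sym compl) ⊤⟶T rT c)
... | good c ¬q     | _             = inj₁ (inj₂ (inj₂ (inj₂ (S , (⊤⟶S , Robust⇒irreducible a rS) , c , ¬q))))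
... | _             | good c ¬q     = inj₂ (inj₂ (inj₂ (inj₂ (T , (⊤⟶T , Robust⇒irreducible b rT) , c , ¬q))))
... | empty S≡0     | empty T≡0     = ⊥-elim (¬both-empty compl 12≤n ⊤⟶S ⊤⟶T S≡0 T≡0)
... | empty S≡0     | clique 5≤T q  = core-clique⇒Good compl 12≤n ⊤⟶T 5≤T q ⊤⟶S
  λ 3≤ → ⊥-elim (<⇒≱ (≤-trans (s≤s z≤n) 3≤) (≤-reflexive S≡0))
... | clique 5≤S q  | empty T≡0     = swap (core-clique⇒Good (Complementary-sym compl) 12≤n ⊤⟶S 5≤S q ⊤⟶T
  λ 3≤ → ⊥-elim (<⇒≱ (≤-trans (s≤s z≤n) 3≤) (≤-reflexive T≡0)))
... | clique 5≤S p  | clique 5≤T q  = core-clique⇒Good compl 12≤n ⊤⟶T 5≤T q ⊤⟶S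
  λ _ → crossEdges-clique compl p q 5≤S

-- The boolean complement forms a complementary pair, and the theorem follows.

complementary : (a : Adj n) → IsSimpleGraph a → Complementary a (complement a)
complementary a simple@(symm , irrefl) = record
  { simpleˡ = simple
  ; simpleʳ = (λ i j → cong₂ _∧_ (cong not (symm i j)) (cong not (≟-sym i j))) , irrefl′
  ; flips   = flips′
  }
  where
  ≟-sym : ∀ (i j : Fin _) → ⌊ i ≟ j ⌋ ≡ ⌊ j ≟ i ⌋
  ≟-sym i j with i ≟ j | j ≟ i
  ... | yes _ | yes _ = refl
  ... | no _  | no _  = refl
  ... | yes e | no ne = ⊥-elim (ne (sym e))
  ... | no ne | yes e = ⊥-elim (ne (sym e))
  irrefl′ : ∀ i → complement a i i ≡ false
  irrefl′ i with i ≟ i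
  ... | yes _ = ∧-zeroʳ _
  ... | no ne = ⊥-elim (ne refl)
  flips′ : ∀ {u v} → u ≢ v → complement a u v ≡ not (a u v)
  flips′ {u} {v} u≢v with u ≟ v
  ... | yes e = ⊥-elim (u≢v e)
  ... | no _  = ∧-identityʳ _

theorem5p1 : (n : ℕ) → 12 ≤ n → (H : Adj n) → IsSimpleGraph H →
    Good H ⊎ Good (complement H)
theorem5p1 n 12≤n H simple = Complementary⇒Good (complementary H simple) 12≤n
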